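{- For every $\epsilon>0$ there exists $v_0(\epsilon)$ such that for every integer $v>v_0$ with $v\equiv 1\pmod 3$ there exists a $2-(v,4,1)$ directed design $\mathcal{D}$ with $f(\mathcal{D})\geq \frac{5}{8}-\frac{c}{v}$, where $c=\frac{13}{8}+\epsilon$.
   Context: A $2-(v,4,1)$ directed design is a pair $(V,\mathcal{B})$ with $|V|=v$ and $\mathcal{B}$ a collection of ordered 4-tuples of distinct elements of $V$ (blocks) such that every ordered pair $(x,y)$ of distinct elements of $V$ appears in exactly one block (i.e. $x$ and $y$ both occur in it with $x$ before $y$). A defining set of $\mathcal{D}=(V,\mathcal{B})$ is a subset $S\subseteq\mathcal{B}$ contained in no other $2-(v,4,1)$ directed design on $V$. $f(\mathcal{D})$ denotes the minimum cardinality of a defining set of $\mathcal{D}$ divided by $|\mathcal{B}|$. -}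

module Defs where

open import Data.Nat using (ℕ; zero; suc)
open import Data.Fin using (Fin; _<_)
open import Data.Vec using (Vec; lookup)
open import Data.List using (List; length)
import Data.List as List
open import Data.List.Membership.Propositional using (_∈_)
open import Data.List.Relation.Unary.Unique.Propositional using (Unique)
open import Data.Product using (Σ; _×_)
open import Data.Integer using (+_)
open import Data.Rational using (ℚ; 0ℚ; _/_)
open import Relation.Binary.PropositionalEquality using (_≡_; _≢_)
open import Relation.Nullary using (¬_)
open import Function.Bundles using (_⇔_)

Block : ℕ → Set
Block v = Vec (Fin v) 4

DistinctEntries : ∀ {v} → Block v → Set
DistinctEntries b = ∀ i j → lookup b i ≡ lookup b j → i ≡ j

Appears : ∀ {v} → Fin v → Fin v → Block v → Set
Appears x y b = Σ (Fin 4) λ i → Σ (Fin 4) λ j →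
  (i < j) × (lookup b i ≡ x) × (lookup b j ≡ y)

-- (Fin v , B) is a 2-(v,4,1) directed design: blocks are 4-tuples of
-- distinct points, and every ordered pair of distinct points appears in
-- exactly one block of B (blocks counted with multiplicity via positions).
IsDirectedDesign : (v : ℕ) → List (Block v) → Set
IsDirectedDesign v B =
  (∀ b → b ∈ B → DistinctEntries b) ×
  (∀ (x y : Fin v) → x ≢ y →
     Σ (Fin (length B)) λ k →
       Appears x y (List.lookup B k) ×
       (∀ k′ → Appears x y (List.lookup B k′) → k′ ≡ k))

_⊆_ : ∀ {A : Set} → List A → List A → Set
S ⊆ T = ∀ {b} → b ∈ S → b ∈ T

IsDefiningSet : (v : ℕ) → List (Block v) → List (Block v) → Set
IsDefiningSet v B S =
  Unique S × (S ⊆ B) ×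
  (∀ B′ → IsDirectedDesign v B′ → S ⊆ B′ → ∀ b → (b ∈ B′ ⇔ b ∈ B))

-- n / d as a rational number (only used with d ≠ 0; value 0 when d = 0)
_/ℕ_ : ℕ → ℕ → ℚ
n /ℕ zero = 0ℚ
n /ℕ suc d = (+ n) / suc d

{-# OPTIONS --safe #-}

-- If one block contains x y and another one y x, both in adjacent positions, then exchanging x and y in
-- the two blocks gives another directed design, so a defining set contains one of them; it therefore
-- contains two of any three pairwise linked blocks. Hence f(D) ≥ 2/3 - O(1/v) > 5/8 as soon as all but
-- O(v) of the blocks of D fall into disjoint linked triangles.
-- Such designs arise from directed group divisible designs of type 3ᵐ by adding a point at infinity. In a
-- transversal design with groups truncated to the sizes t, t, t, t, u, w every line has 4, 5 or 6 points;
-- replacing it by a design of type 3⁴ or 3⁵ made of triangles, or of type 3⁶, and each group by a smaller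
-- design gives type 3ᵐ for m = 4t + u + w. With t = 6a + 1 and few values of u, w this reaches all large m
-- from finitely many difference families. Only the at most u w lines of size 6, the groups and the point
-- at infinity contribute blocks outside triangles, and these remain O(m) in number.

module Submission where

open import Defs
open import Data.Nat using (ℕ; _%_)
import Data.Nat as ℕ
open import Data.List using (List; length)
open import Data.Product using (Σ; _×_)
open import Data.Integer using (+_)
open import Data.Rational using (ℚ; 0ℚ; _+_; _-_; _*_; _/_; _≤_; _<_)
open import Relation.Binary.PropositionalEquality using (_≡_)

open import Level using (Level; _⊔_)
open import Data.Empty using (⊥; ⊥-elim)
open import Data.Fin using (Fin; zero; suc; toℕ; combine; remQuot; inject≤; #_)
import Data.Fin as Fin
open import Data.Fin.Properties as Fin
  using (toℕ-fromℕ<; toℕ-injective; toℕ<n; any?; all?; punchOut-injective; injective⇒≤; combine-remQuot;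
         remQuot-combine; inject≤-injective; inject≤-refl; +↔⊎; *↔×; <-cmp)
open import Data.Integer as ℤ using (ℤ; ∣_∣)
import Data.Integer.Divisibility.Signed as ℤ
import Data.Integer.Properties as ℤ
open import Data.Integer.Tactic.RingSolver using () renaming (solve-∀ to solve-∀-ℤ)
open import Data.List
  using ([]; _∷_; _++_; map; concatMap; filter; allFin; cartesianProduct; iterate; applyUpTo)
import Data.List as List
open import Data.List.Membership.Propositional using (_∈_; _∉_; lose)
open import Data.List.Membership.Propositional.Properties
  using (∈-lookup; ∈-allFin; ∈-cartesianProduct⁺; ∈-map⁺; ∈-map⁻; ∈-filter⁻; ∈-++⁺ˡ; ∈-++⁺ʳ; ∈-++⁻; ∈-∃++;
         ∈-concatMap⁺; ∈-applyUpTo⁺)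
import Data.List.Membership.DecPropositional as DecMembership
open import Data.List.Properties
  using (map-++; concatMap-map; concatMap-++; concatMap-cong; length-++; length-map; length-tabulate;
         filter-++; filter-accept; filter-reject)
open import Data.List.Relation.Unary.All as All using (All; []; _∷_)
import Data.List.Relation.Unary.All.Properties as All
open import Data.List.Relation.Unary.AllPairs using ([]; _∷_)
open import Data.List.Relation.Unary.Any using (Any; here; there)
open import Data.List.Relation.Unary.Unique.Propositional using (Unique)
open import Data.List.Relation.Unary.Unique.Propositional.Properties
  using (allFin⁺; cartesianProduct⁺; filter⁺)
open import Data.Nat using (zero; suc; NonZero; z≤n; s≤s)
open import Data.Nat.Coprimality using (Coprime; coprime?; coprime-divisor)
import Data.Nat.Divisibility as ℕ
open import Data.Nat.DivMod
  using (_mod_; m≡m%n+[m/n]*n; m%n<n; m%n≤n; m<n⇒m%n≡m; m%n%n≡m%n; [m+kn]%n≡m%n; %-distribˡ-+; /-monoˡ-≤)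
open import Data.Nat.Induction using (<-rec)
open import Data.Nat.ListAction using (sum)
open import Data.Nat.ListAction.Properties using (sum-++)
import Data.Nat.Properties as ℕ
open import Data.Nat.Tactic.RingSolver using () renaming (solve-∀ to solve-∀-ℕ)
open import Data.Product using (∃; _,_; proj₁; proj₂; swap; uncurry; map₁)
open import Data.Product.Properties using (≡-dec)
open import Data.Rational using (fromℚᵘ; toℚᵘ)
import Data.Rational as ℚ
import Data.Rational.Properties as ℚ
open import Data.Rational.Unnormalised using (mkℚᵘ; *≤*)
import Data.Rational.Unnormalised.Properties as ℚᵘ
open import Data.Sum using (_⊎_; inj₁; inj₂)
open import Data.Sum.Function.Propositional using (_⊎-↔_)
open import Data.Sum.Properties using (inj₂-injective)
open import Data.Unit using (⊤; tt)
open import Data.Vec using (Vec; []; _∷_; lookup)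
import Data.Vec as Vec
open import Data.Vec.Properties using () renaming (≡-dec to Vec-≡-dec)
open import Data.Vec.Relation.Unary.All using ([]; _∷_)
open import Data.Vec.Relation.Unary.All.Properties using (lookup⁺)
open import Function using (_∘_; id; _↔_; Inverse; mk↔ₛ′)
open import Function.Bundles using (Equivalence)
open import Function.Construct.Composition using (_↔-∘_)
open import Function.Construct.Symmetry using (↔-sym)
open import Function.Properties.Inverse using (↔-refl)
open import Relation.Binary.Definitions using (DecidableEquality; tri<; tri≈; tri>)
open import Relation.Binary.PropositionalEquality
  using (_≢_; refl; sym; trans; cong; cong₂; subst; subst₂; module ≡-Reasoning)
open import Relation.Nullary using (Dec; yes; no; ¬_)
open import Relation.Nullary.Decidable
  using (True; toWitness; from-yes; map′; ¬?; _→-dec_; _×-dec_; decidable-stable)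
open import Relation.Unary using (Decidable)

-- The obstacle is to keep the blocks outside triangles linear in m through a recursion of unbounded
-- depth. Each step adds up to 45 u w of them, so a bound k m is not inherited as it stands. A bound
-- k m - e is: the design on a group of size t enters four times and saves e each time, and the long
-- lines use up only three of these savings. The truncated groups contribute no saving, which is why
-- small orders may fill them. The shape of t comes from the parallel classes: any two of the six
-- must be transversal modulo t, and the determinants of the slopes divide 12, so t has to be
-- coprime to 12. Fixing t = 1 modulo 6 makes 4 t advance in steps of 24, and the sums u + w fill
-- the steps. The exceptional blocks may consume the gap 2/3 - 5/8 = 1/24: with s of them, a
-- defining set has at least 2/3 (|B| - s) blocks, so 16 s ≤ |B| is enough. As |B| is quadratic in v
-- and s is linear, this holds for large v.

private variable
  ℓ ℓ₁ ℓ₂ : Level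
  T U V : Set ℓ
  A K X Y : Set

-- Lists with exactly one element satisfying a predicate

None : {T : Set ℓ} → (T → Set ℓ₁) → List T → Set (ℓ ⊔ ℓ₁)
None P = All (¬_ ∘ P)

-- Counts positions, so a repeated entry is two occurrences, in agreement with `IsDirectedDesign`.
-- The inductive form can be split along `++` and `concatMap`.
data One {T : Set ℓ} (P : T → Set ℓ₁) : List T → Set (ℓ ⊔ ℓ₁) where
  here  : ∀ {x xs} → P x → None P xs → One P (x ∷ xs)
  there : ∀ {x xs} → ¬ P x → One P xs → One P (x ∷ xs)

module _ {P : T → Set ℓ₁} {Q : T → Set ℓ₂} where

  one-cong : ∀ {xs} → (∀ {z} → z ∈ xs → P z → Q z) → (∀ {z} → z ∈ xs → Q z → P z) →
             One P xs → One Q xs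
  one-cong f g (here p ps)  =
    here (f (here refl) p) (All.tabulate λ z∈ q → All.lookup ps z∈ (g (there z∈) q))
  one-cong f g (there ¬p o) = there (¬p ∘ g (here refl)) (one-cong (f ∘ there) (g ∘ there) o)

module _ {P : U → Set ℓ₁} {f : T → U} where

  one-map⁺ : ∀ {xs} → One (P ∘ f) xs → One P (map f xs)
  one-map⁺ (here p ps)  = here p (All.map⁺ ps)
  one-map⁺ (there ¬p o) = there ¬p (one-map⁺ o)

module _ {P : T → Set ℓ₁} where

  one-++ˡ : ∀ {xs ys} → One P xs → None P ys → One P (xs ++ ys)
  one-++ˡ (here p ps)  n = here p (All.++⁺ ps n)
  one-++ˡ (there ¬p o) n = there ¬p (one-++ˡ o n)

  one-++ʳ : ∀ {xs ys} → None P xs → One P ys → One P (xs ++ ys)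
  one-++ʳ []       o = o
  one-++ʳ (¬p ∷ n) o = there ¬p (one-++ʳ n o)

  one-++⁻ : ∀ xs {ys} → One P (xs ++ ys) → One P xs × None P ys ⊎ None P xs × One P ys
  one-++⁻ []       o = inj₂ ([] , o)
  one-++⁻ (x ∷ xs) (here p ps) = inj₁ (here p (All.++⁻ˡ xs ps) , All.++⁻ʳ xs ps)
  one-++⁻ (x ∷ xs) (there ¬p o) with one-++⁻ xs o
  ... | inj₁ (o′ , n) = inj₁ (there ¬p o′ , n)
  ... | inj₂ (n , o′) = inj₂ (¬p ∷ n , o′)

  one-witness : ∀ {xs} → One P xs → ∃ λ x → x ∈ xs × P x
  one-witness (here p _)  = _ , here refl , p
  one-witness (there _ o) with one-witness o
  ... | x , x∈ , p = x , there x∈ , p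

  one-unique : ∀ {xs x y} → One P xs → x ∈ xs → P x → y ∈ xs → P y → x ≡ y
  one-unique (here _ n)   (here refl) _ (here refl) _ = refl
  one-unique (here _ n)   (here refl) _ (there y∈)  q = ⊥-elim (All.lookup n y∈ q)
  one-unique (here _ n)   (there x∈)  p _           _ = ⊥-elim (All.lookup n x∈ p)
  one-unique (there ¬p o) (here refl) p _           _ = ⊥-elim (¬p p)
  one-unique (there ¬p o) (there _)   _ (here refl) q = ⊥-elim (¬p q)
  one-unique (there ¬p o) (there x∈)  p (there y∈)  q = one-unique o x∈ p y∈ q

  unique⇒one : ∀ {xs x} → Unique xs → x ∈ xs → P x → (∀ {y} → P y → y ≡ x) → One P xs
  unique⇒one (x∉ ∷ u) (here refl) p only =
    here p (All.map (λ x≢y q → x≢y (sym (only q))) x∉)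
  unique⇒one (x∉ ∷ u) (there x∈)  p only =
    there (λ q → All.lookup x∉ x∈ (only q)) (unique⇒one u x∈ p only)

  one-lookup : ∀ {xs} → One P xs →
    Σ (Fin (length xs)) λ k → P (List.lookup xs k) × (∀ k′ → P (List.lookup xs k′) → k′ ≡ k)
  one-lookup {x ∷ xs} (here p n) = zero , p , only
    where only : ∀ k′ → P (List.lookup (x ∷ xs) k′) → k′ ≡ zero
          only zero     _ = refl
          only (suc k′) q = ⊥-elim (All.lookup n (∈-lookup k′) q)
  one-lookup {x ∷ xs} (there ¬p o) with one-lookup o
  ... | k , p , only = suc k , p , only′
    where only′ : ∀ k′ → P (List.lookup (x ∷ xs) k′) → k′ ≡ suc k
          only′ zero     q = ⊥-elim (¬p q)
          only′ (suc k′) q = cong suc (only k′ q)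

  one? : (∀ x → Dec (P x)) → ∀ xs → Dec (One P xs)
  one? P? []       = no λ ()
  one? P? (x ∷ xs) with P? x
  ... | yes p = map′ (here p) (λ { (here _ n) → n ; (there ¬p _) → ⊥-elim (¬p p) }) (All.all? (¬? ∘ P?) xs)
  ... | no ¬p = map′ (there ¬p) (λ { (here p _) → ⊥-elim (¬p p) ; (there _ o) → o }) (one? P? xs)

module _ {P : U → Set ℓ₁} (Q : T → Set ℓ₂) {f : T → List U}
         (some : ∀ j → Q j → One P (f j)) (none : ∀ j → ¬ Q j → None P (f j)) where

  none-concatMap⁺ : ∀ {js} → None Q js → None P (concatMap f js)
  none-concatMap⁺ []       = []
  none-concatMap⁺ (¬q ∷ n) = All.++⁺ (none _ ¬q) (none-concatMap⁺ n)

  -- Counting on two levels: a single index accounts for the hit, and the list at this index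
  -- contains it once. Unions of pieces and translates of base blocks are both counted in this way.
  one-concatMap⁺ : ∀ {js} → One Q js → One P (concatMap f js)
  one-concatMap⁺ (here q n)   = one-++ˡ (some _ q) (none-concatMap⁺ n)
  one-concatMap⁺ (there ¬q o) = one-++ʳ (none _ ¬q) (one-concatMap⁺ o)

module _ {P : U → Set ℓ₁} {f : T → List U} where

  -- Serves to pass from pairs to blocks: a pair listed once over all blocks belongs to exactly one
  -- block.
  one-concatMap⁻ : ∀ js → One P (concatMap f js) → One (Any P ∘ f) js
  one-concatMap⁻ (j ∷ js) o with one-++⁻ (f j) o
  ... | inj₂ (n , o′) = there (All.All¬⇒¬Any n) (one-concatMap⁻ js o′)
  ... | inj₁ (o′ , n) with one-witness o′
  ... | x , x∈ , p = here (lose x∈ p) (none-js js n)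
    where
    none-js : ∀ js → None P (concatMap f js) → None (Any P ∘ f) js
    none-js []       _ = []
    none-js (j ∷ js) n = All.All¬⇒¬Any (All.++⁻ˡ (f j) n) ∷ none-js js (All.++⁻ʳ (f j) n)

module _ {P : U → Set ℓ₁} {Q : V → Set ℓ₂} {f : T → List U} {g : T → List V}
         (some : ∀ j → One P (f j) → One Q (g j)) (none : ∀ j → None P (f j) → None Q (g j)) where

  none-transfer : ∀ js → None P (concatMap f js) → None Q (concatMap g js)
  none-transfer []       _ = []
  none-transfer (j ∷ js) n = All.++⁺ (none j (All.++⁻ˡ (f j) n)) (none-transfer js (All.++⁻ʳ (f j) n))

  -- Compares two families index by index. In the use below, the pairs of a base cluster with a
  -- given difference are compared with the occurrences of a pair of points in the orbit of that
  -- cluster.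
  one-transfer : ∀ js → One P (concatMap f js) → One Q (concatMap g js)
  one-transfer (j ∷ js) o with one-++⁻ (f j) o
  ... | inj₁ (o′ , n) = one-++ˡ (some j o′) (none-transfer js n)
  ... | inj₂ (n , o′) = one-++ʳ (none j n) (one-transfer js o′)

unique-⊆⇒length-≤ : ∀ {xs ys : List A} → Unique xs → (∀ {x} → x ∈ xs → x ∈ ys) → length xs ℕ.≤ length ys
unique-⊆⇒length-≤ [] _ = z≤n
unique-⊆⇒length-≤ {xs = x ∷ xs} (x∉ ∷ u) sub with ∈-∃++ (sub (here refl))
... | as , bs , refl = begin
  suc (length xs)           ≤⟨ s≤s (unique-⊆⇒length-≤ u sub′) ⟩
  suc (length (as ++ bs))   ≡⟨ cong suc (length-++ as) ⟩
  suc (length as ℕ.+ length bs) ≡⟨ ℕ.+-suc (length as) (length bs) ⟨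
  length as ℕ.+ length (x ∷ bs) ≡⟨ length-++ as ⟨
  length (as ++ x ∷ bs) ∎
  where
  open ℕ.≤-Reasoning
  sub′ : ∀ {y} → y ∈ xs → y ∈ as ++ bs
  sub′ y∈ with ∈-++⁻ as (sub (there y∈))
  ... | inj₁ y∈as         = ∈-++⁺ˡ y∈as
  ... | inj₂ (here refl)  = ⊥-elim (All.lookup x∉ y∈ refl)
  ... | inj₂ (there y∈bs) = ∈-++⁺ʳ as y∈bs

length-cartesianProduct : ∀ {A B : Set} (xs : List A) (ys : List B) →
                          length (cartesianProduct xs ys) ≡ length xs ℕ.* length ys
length-cartesianProduct []       ys = refl
length-cartesianProduct (x ∷ xs) ys = trans (length-++ (map (x ,_) ys))
  (cong₂ ℕ._+_ (length-map (x ,_) ys) (length-cartesianProduct xs ys))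

-- Partial designs and their unions

pairs : Vec X 4 → List (X × X)
pairs (a ∷ b ∷ c ∷ d ∷ []) = (a , b) ∷ (a , c) ∷ (a , d) ∷ (b , c) ∷ (b , d) ∷ (c , d) ∷ []

adjacent : Vec X 4 → Fin 3 → X × X
adjacent (a ∷ b ∷ c ∷ d ∷ []) zero             = a , b
adjacent (a ∷ b ∷ c ∷ d ∷ []) (suc zero)       = b , c
adjacent (a ∷ b ∷ c ∷ d ∷ []) (suc (suc zero)) = c , d

Linked : Vec X 4 → Vec X 4 → Set
Linked b c = ∃ λ i → ∃ λ j → adjacent b i ≡ swap (adjacent c j)

-- The grouping into triangles is part of the data, so `singles` can be followed through a
-- construction and no triangle has to be found in the result.
data Cluster (X : Set) : Set where
  one : Vec X 4 → Cluster X
  tri : Vec X 4 → Vec X 4 → Vec X 4 → Cluster X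

Triangle : Cluster X → Set
Triangle (one b)     = ⊤
Triangle (tri b c d) = Linked b c × Linked b d × Linked c d

members : Cluster X → List (Vec X 4)
members (one b)     = b ∷ []
members (tri b c d) = b ∷ c ∷ d ∷ []

blocks : List (Cluster X) → List (Vec X 4)
blocks = concatMap members

clusterPairs : Cluster X → List (X × X)
clusterPairs = concatMap pairs ∘ members

pairsOf : List (Cluster X) → List (X × X)
pairsOf = concatMap clusterPairs

singles : List (Cluster X) → ℕ
singles []                = 0
singles (one _ ∷ cs)      = suc (singles cs)
singles (tri _ _ _ ∷ cs)  = singles cs

mapCluster : (X → Y) → Cluster X → Cluster Y
mapCluster f (one b)     = one (Vec.map f b)
mapCluster f (tri b c d) = tri (Vec.map f b) (Vec.map f c) (Vec.map f d)

mapPair : (X → Y) → X × X → Y × Y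
mapPair f (x , y) = f x , f y

module _ (f : X → Y) where

  adjacent-map : ∀ b i → adjacent (Vec.map f b) i ≡ mapPair f (adjacent b i)
  adjacent-map (a ∷ b ∷ c ∷ d ∷ []) zero             = refl
  adjacent-map (a ∷ b ∷ c ∷ d ∷ []) (suc zero)       = refl
  adjacent-map (a ∷ b ∷ c ∷ d ∷ []) (suc (suc zero)) = refl

  linked-map : ∀ b c → Linked b c → Linked (Vec.map f b) (Vec.map f c)
  linked-map b c (i , j , eq) = i , j ,
    trans (adjacent-map b i) (trans (cong (mapPair f) eq) (cong swap (sym (adjacent-map c j))))

  triangle-map : ∀ {c} → Triangle c → Triangle (mapCluster f c)
  triangle-map {one _}     _           = _
  triangle-map {tri b c d} (p , q , r) = linked-map b c p , linked-map b d q , linked-map c d r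

  clusterPairs-map : ∀ c → clusterPairs (mapCluster f c) ≡ map (mapPair f) (clusterPairs c)
  clusterPairs-map (one (_ ∷ _ ∷ _ ∷ _ ∷ [])) = refl
  clusterPairs-map (tri (_ ∷ _ ∷ _ ∷ _ ∷ []) (_ ∷ _ ∷ _ ∷ _ ∷ []) (_ ∷ _ ∷ _ ∷ _ ∷ [])) = refl

  pairsOf-map : ∀ cs → pairsOf (map (mapCluster f) cs) ≡ map (mapPair f) (pairsOf cs)
  pairsOf-map []       = refl
  pairsOf-map (c ∷ cs) = trans (cong₂ _++_ (clusterPairs-map c) (pairsOf-map cs))
                               (sym (map-++ (mapPair f) (clusterPairs c) (pairsOf cs)))

  singles-map : ∀ cs → singles (map (mapCluster f) cs) ≡ singles cs
  singles-map []               = refl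
  singles-map (one _ ∷ cs)     = cong suc (singles-map cs)
  singles-map (tri _ _ _ ∷ cs) = singles-map cs

singles-++ : ∀ (cs ds : List (Cluster X)) → singles (cs ++ ds) ≡ singles cs ℕ.+ singles ds
singles-++ []               ds = refl
singles-++ (one _ ∷ cs)     ds = cong suc (singles-++ cs ds)
singles-++ (tri _ _ _ ∷ cs) ds = singles-++ cs ds

pairsOf-concatMap : ∀ {a} {A : Set a} (f : A → List (Cluster X)) js →
                    pairsOf (concatMap f js) ≡ concatMap (pairsOf ∘ f) js
pairsOf-concatMap f []       = refl
pairsOf-concatMap f (j ∷ js) = trans (concatMap-++ clusterPairs (f j) (concatMap f js))
                                     (cong (pairsOf (f j) ++_) (pairsOf-concatMap f js))

Cross : Set → Set₁
Cross X = X → X → Set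

-- Phrased on the list of ordered pairs, so that it passes through injective maps and unions. When
-- the relation is `_≢_`, the field `never` at `(x , x)` is what makes the entries of a block
-- distinct.
record Design (X : Set) (_#_ : Cross X) : Set where
  field
    clusters  : List (Cluster X)
    triangles : All Triangle clusters
    once      : ∀ {x y} → x # y → One ((x , y) ≡_) (pairsOf clusters)
    never     : ∀ {x y} → ¬ x # y → None ((x , y) ≡_) (pairsOf clusters)

open Design public

record Piece (X : Set) : Set₁ where
  field
    {Point}   : Set
    {_#_}     : Cross Point
    design    : Design Point _#_
    embed     : Point → X
    injective : ∀ {k l} → embed k ≡ embed l → k ≡ l

  Covers : Cross X
  Covers x y = ∃ λ k → ∃ λ l → embed k ≡ x × embed l ≡ y × k # l

  image : List (Cluster X)
  image = map (mapCluster embed) (clusters design)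

  image-triangles : All Triangle image
  image-triangles = All.map⁺ (All.map (triangle-map embed) (triangles design))

  image-once : ∀ {x y} → Covers x y → One ((x , y) ≡_) (pairsOf image)
  image-once (k , l , refl , refl , k#l) =
    subst (One _) (sym (pairsOf-map embed (clusters design)))
      (one-map⁺ (one-cong (λ _ → cong (mapPair embed))
                          (λ _ eq → cong₂ _,_ (injective (cong proj₁ eq)) (injective (cong proj₂ eq)))
                          (once design k#l)))

  image-never : ∀ {x y} → ¬ Covers x y → None ((x , y) ≡_) (pairsOf image)
  image-never ¬c = subst (None _) (sym (pairsOf-map embed (clusters design)))
    (All.map⁺ (All.tabulate λ { {k , l} k,l∈ refl →
      All.lookup (never design λ k#l → ¬c (k , l , refl , refl , k#l)) k,l∈ refl }))

open Piece public using (Covers; image)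
open Piece using (image-triangles; image-once; image-never)

module _ {X : Set} (_#_ : Cross X) (ps : List (Piece X))
         (cover : ∀ {x y} → x # y → One (λ p → Covers p x y) ps)
         (avoid : ∀ {x y} → ¬ x # y → None (λ p → Covers p x y) ps) where

  union : Design X _#_
  union .clusters       = concatMap image ps
  union .triangles      = All.concat⁺ (All.map⁺ (All.universal image-triangles ps))
  union .once  {x} {y} x#y = subst (One _) (sym (pairsOf-concatMap image ps))
    (one-concatMap⁺ (λ p → Covers p x y) (λ p → image-once p) (λ p → image-never p) (cover x#y))
  union .never {x} {y} ¬# = subst (None _) (sym (pairsOf-concatMap image ps))
    (none-concatMap⁺ (λ p → Covers p x y) (λ p → image-once p) (λ p → image-never p) (avoid ¬#))

excess : Piece X → ℕ
excess p = singles (clusters (Piece.design p))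

singles-union : ∀ (ps : List (Piece X)) → singles (concatMap image ps) ≡ sum (map excess ps)
singles-union []       = refl
singles-union (p ∷ ps) = trans (singles-++ (image p) (concatMap image ps))
  (cong₂ ℕ._+_ (singles-map (Piece.embed p) (clusters (Piece.design p))) (singles-union ps))

-- Linear congruences modulo t

-- If `y` were missed, punching it out would leave an injection of `Fin (suc n)` into `Fin n`.
injective⇒surjective : ∀ {n} (f : Fin n → Fin n) → (∀ {i j} → f i ≡ f j → i ≡ j) → ∀ y → ∃ λ x → f x ≡ y
injective⇒surjective {suc n} f inj y with any? (λ x → f x Fin.≟ y)
... | yes p  = p
... | no ¬p  = ⊥-elim (ℕ.1+n≰n (injective⇒≤ {f = λ x → Fin.punchOut (y≢f x)}
                 λ eq → inj (punchOut-injective (y≢f _) (y≢f _) eq)))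
  where y≢f : ∀ x → y ≢ f x
        y≢f x eq = ¬p (x , sym eq)

injective⇒surjective² : ∀ {n} (f : Fin n × Fin n → Fin n × Fin n) → (∀ {p q} → f p ≡ f q → p ≡ q) →
                        ∀ q → ∃ λ p → f p ≡ q
injective⇒surjective² {n} f inj q =
  let x , eq = injective⇒surjective (uncurry combine ∘ f ∘ remQuot n)
                 (λ {i} {j} eq → remQuot-injective
                   (inj (combine-injective (f (remQuot n i)) (f (remQuot n j)) eq)))
                 (uncurry combine q)
  in remQuot n x , combine-injective (f (remQuot n x)) q eq
  where
  combine-injective : ∀ (p q : Fin n × Fin n) → uncurry combine p ≡ uncurry combine q → p ≡ q
  combine-injective (i , j) (k , l) eq =
    trans (sym (remQuot-combine i j)) (trans (cong (remQuot n) eq) (remQuot-combine k l))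
  remQuot-injective : ∀ {i j : Fin (n ℕ.* n)} → remQuot n i ≡ remQuot n j → i ≡ j
  remQuot-injective {i} {j} eq =
    trans (sym (combine-remQuot {n} n i)) (trans (cong (uncurry combine) eq) (combine-remQuot {n} n j))

module _ (t : ℕ) .{{_ : NonZero t}} where

  mod-≡⇒∣ : ∀ a b → a mod t ≡ b mod t → + t ℤ.∣ (+ a ℤ.- + b)
  mod-≡⇒∣ a b eq = ℤ.divides (+ (a ℕ./ t) ℤ.- + (b ℕ./ t)) (begin
    + a ℤ.- + b
      ≡⟨ cong₂ (λ x y → + x ℤ.- + y) (m≡m%n+[m/n]*n a t) (m≡m%n+[m/n]*n b t) ⟩
    + (a % t ℕ.+ a ℕ./ t ℕ.* t) ℤ.- + (b % t ℕ.+ b ℕ./ t ℕ.* t)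
      ≡⟨ cong (λ x → + (x ℕ.+ a ℕ./ t ℕ.* t) ℤ.- + (b % t ℕ.+ b ℕ./ t ℕ.* t)) a%≡b% ⟩
    + (b % t ℕ.+ a ℕ./ t ℕ.* t) ℤ.- + (b % t ℕ.+ b ℕ./ t ℕ.* t)
      ≡⟨ cong₂ ℤ._-_ (push (b % t) (a ℕ./ t)) (push (b % t) (b ℕ./ t)) ⟩
    (+ (b % t) ℤ.+ + (a ℕ./ t) ℤ.* + t) ℤ.- (+ (b % t) ℤ.+ + (b ℕ./ t) ℤ.* + t)
      ≡⟨ ring (+ (b % t)) (+ (a ℕ./ t)) (+ (b ℕ./ t)) (+ t) ⟩
    (+ (a ℕ./ t) ℤ.- + (b ℕ./ t)) ℤ.* + t ∎)
    where
    open ≡-Reasoning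
    a%≡b% : a % t ≡ b % t
    a%≡b% = trans (sym (toℕ-fromℕ< (m%n<n a t))) (trans (cong toℕ eq) (toℕ-fromℕ< (m%n<n b t)))
    push : ∀ x q → + (x ℕ.+ q ℕ.* t) ≡ + x ℤ.+ + q ℤ.* + t
    push x q = trans (ℤ.pos-+ x (q ℕ.* t)) (cong (ℤ._+_ (+ x)) (ℤ.pos-* q t))
    ring : ∀ r p q t → (r ℤ.+ p ℤ.* t) ℤ.- (r ℤ.+ q ℤ.* t) ≡ (p ℤ.- q) ℤ.* t
    ring = solve-∀-ℤ

  ∣-difference⇒≡ : ∀ (r r′ : Fin t) → + t ℤ.∣ (+ toℕ r ℤ.- + toℕ r′) → r ≡ r′
  ∣-difference⇒≡ r r′ t∣ = toℕ-injective
    (ℤ.+-injective (ℤ.i-j≡0⇒i≡j _ _ (ℤ.∣i∣≡0⇒i≡0 (small (ℤ.∣⇒∣ᵤ t∣) bound))))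
    where
    bound : ∣ + toℕ r ℤ.- + toℕ r′ ∣ ℕ.< t
    bound = ℕ.≤-<-trans (ℕ.≤-reflexive (cong ∣_∣ (ℤ.m-n≡m⊖n (toℕ r) (toℕ r′))))
              (ℕ.≤-<-trans (ℤ.∣m⊝n∣≤m⊔n (toℕ r) (toℕ r′)) (ℕ.⊔-pres-<m (toℕ<n r) (toℕ<n r′)))
    small : ∀ {n} → t ℕ.∣ n → n ℕ.< t → n ≡ 0
    small {zero}  _ _ = refl
    small {suc n} d lt = ⊥-elim (ℕ.<⇒≱ lt (ℕ.∣⇒≤ d))

  cancel-divisor : ∀ {n} → Coprime t n → ∀ D x → ∣ D ∣ ℕ.∣ n → + t ℤ.∣ (D ℤ.* x) → + t ℤ.∣ x
  cancel-divisor coprime D x D∣n t∣ = ℤ.∣ᵤ⇒∣ (coprime-divisor {n = ∣ D ∣}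
    (λ (p , q) → coprime (p , ℕ.∣-trans q D∣n))
    (subst (t ℕ.∣_) (ℤ.abs-* D x) (ℤ.∣⇒∣ᵤ t∣)))

-- The six parallel classes r, s, r+s, r+2s, r+3s, r+4s: all their 2×2 determinants divide 12.
slopeᵣ slopeₛ : Fin 6 → ℕ
slopeᵣ = lookup (1 ∷ 0 ∷ 1 ∷ 1 ∷ 1 ∷ 1 ∷ [])
slopeₛ = lookup (0 ∷ 1 ∷ 1 ∷ 2 ∷ 3 ∷ 4 ∷ [])

determinant : Fin 6 → Fin 6 → ℤ
determinant g h = + slopeᵣ g ℤ.* + slopeₛ h ℤ.- + slopeᵣ h ℤ.* + slopeₛ g

determinant∣12 : ∀ g h → g ≢ h → ∣ determinant g h ∣ ℕ.∣ 12
determinant∣12 = from-yes (all? λ g → all? λ h → ¬? (g Fin.≟ h) →-dec (∣ determinant g h ∣ ℕ.∣? 12))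

module Lines (t : ℕ) .{{_ : NonZero t}} (coprime : Coprime t 12) where

  -- A pair `(r , s)` names a line of the transversal design, and `line g (r , s)` is the point at
  -- which this line meets group `g`.
  line : Fin 6 → Fin t × Fin t → Fin t
  line g (r , s) = (slopeᵣ g ℕ.* toℕ r ℕ.+ slopeₛ g ℕ.* toℕ s) mod t

  line-∣ : ∀ g {r s r′ s′} → line g (r , s) ≡ line g (r′ , s′) →
    + t ℤ.∣ (+ slopeᵣ g ℤ.* (+ toℕ r ℤ.- + toℕ r′) ℤ.+ + slopeₛ g ℤ.* (+ toℕ s ℤ.- + toℕ s′))
  line-∣ g {r} {s} {r′} {s′} eq = subst (+ t ℤ.∣_)
    (trans (cong₂ ℤ._-_ (push r s) (push r′ s′))
      (ring (+ slopeᵣ g) (+ slopeₛ g) (+ toℕ r) (+ toℕ s) (+ toℕ r′) (+ toℕ s′)))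
    (mod-≡⇒∣ t (slopeᵣ g ℕ.* toℕ r ℕ.+ slopeₛ g ℕ.* toℕ s) (slopeᵣ g ℕ.* toℕ r′ ℕ.+ slopeₛ g ℕ.* toℕ s′) eq)
    where
    push : ∀ (r s : Fin t) → + (slopeᵣ g ℕ.* toℕ r ℕ.+ slopeₛ g ℕ.* toℕ s)
                             ≡ + slopeᵣ g ℤ.* + toℕ r ℤ.+ + slopeₛ g ℤ.* + toℕ s
    push r s = trans (ℤ.pos-+ (slopeᵣ g ℕ.* toℕ r) _)
      (cong₂ ℤ._+_ (ℤ.pos-* (slopeᵣ g) (toℕ r)) (ℤ.pos-* (slopeₛ g) (toℕ s)))
    ring : ∀ c d r s r′ s′ → (c ℤ.* r ℤ.+ d ℤ.* s) ℤ.- (c ℤ.* r′ ℤ.+ d ℤ.* s′)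
                             ≡ c ℤ.* (r ℤ.- r′) ℤ.+ d ℤ.* (s ℤ.- s′)
    ring = solve-∀-ℤ

  -- Cramer's rule: eliminating one unknown from the two congruences leaves the determinant times
  -- the difference in the other. The determinant divides 12, hence is coprime to `t` and cancels.
  line-injective : ∀ {g h} → g ≢ h → ∀ {p q} → line g p ≡ line g q → line h p ≡ line h q → p ≡ q
  line-injective {g} {h} g≢h {r , s} {r′ , s′} eqg eqh = cong₂ _,_
    (∣-difference⇒≡ t r r′ (cancel-divisor t coprime (determinant g h) _ (determinant∣12 g h g≢h)
       (subst (+ t ℤ.∣_) (ring₁ cg dg ch dh (+ toℕ r ℤ.- + toℕ r′) (+ toℕ s ℤ.- + toℕ s′))
         (ℤ.∣m∣n⇒∣m-n (ℤ.∣n⇒∣m*n dh eg) (ℤ.∣n⇒∣m*n dg eh)))))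
    (∣-difference⇒≡ t s s′ (cancel-divisor t coprime (determinant g h) _ (determinant∣12 g h g≢h)
       (subst (+ t ℤ.∣_) (ring₂ cg dg ch dh (+ toℕ r ℤ.- + toℕ r′) (+ toℕ s ℤ.- + toℕ s′))
         (ℤ.∣m∣n⇒∣m-n (ℤ.∣n⇒∣m*n cg eh) (ℤ.∣n⇒∣m*n ch eg)))))
    where
    cg dg ch dh : ℤ
    cg = + slopeᵣ g
    dg = + slopeₛ g
    ch = + slopeᵣ h
    dh = + slopeₛ h
    eg = line-∣ g {r} {s} {r′} {s′} eqg
    eh = line-∣ h {r} {s} {r′} {s′} eqh
    ring₁ : ∀ c d c′ d′ x y → d′ ℤ.* (c ℤ.* x ℤ.+ d ℤ.* y) ℤ.- d ℤ.* (c′ ℤ.* x ℤ.+ d′ ℤ.* y)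
                               ≡ (c ℤ.* d′ ℤ.- c′ ℤ.* d) ℤ.* x
    ring₁ = solve-∀-ℤ
    ring₂ : ∀ c d c′ d′ x y → c ℤ.* (c′ ℤ.* x ℤ.+ d′ ℤ.* y) ℤ.- c′ ℤ.* (c ℤ.* x ℤ.+ d ℤ.* y)
                               ≡ (c ℤ.* d′ ℤ.- c′ ℤ.* d) ℤ.* y
    ring₂ = solve-∀-ℤ

  -- Uniqueness gives existence: an injective self-map of the t² pairs is surjective, so no inverse
  -- modulo `t` is computed.
  line-through : ∀ {g h} → g ≢ h → ∀ α β → ∃ λ p → line g p ≡ α × line h p ≡ β
  line-through {g} {h} g≢h α β =
    let p , eq = injective⇒surjective² (λ p → line g p , line h p)
                   (λ eq → line-injective g≢h (cong proj₁ eq) (cong proj₂ eq)) (α , β)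
    in p , cong proj₁ eq , cong proj₂ eq

-- Group divisible designs from truncated transversal designs

DifferentGroup : Cross (X × Fin 3)
DifferentGroup x y = proj₁ x ≢ proj₁ y

-- Each element of `X` is a group of three points, so this is a directed group divisible design of
-- type 3ᵐ with m the size of `X`.
GDD : Set → Set
GDD X = Design (X × Fin 3) DifferentGroup

-- A bijection of `K` with the part of `X` where `P` holds. With `K = Fin n` it records the size of
-- that part, which decides the design to be put on it.
record Listing {X : Set} (K : Set) (P : X → Set) : Set where
  field
    elem      : K → X
    injective : ∀ {k l} → elem k ≡ elem l → k ≡ l
    sound     : ∀ k → P (elem k)
    complete  : ∀ {a} → P a → ∃ λ k → elem k ≡ a

open Listing

module _ {P : X → Set} (L : Listing K P) (D : GDD K) where

  -- Wilson's fundamental construction with weight 3: the listed part of `X` is blown up to triples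
  -- and carries a copy of `D`.
  weighted : Piece (X × Fin 3)
  weighted = record
    { design    = D
    ; embed     = λ (k , i) → elem L k , i
    ; injective = λ eq → cong₂ _,_ (injective L (cong proj₁ eq)) (cong proj₂ eq) }

  covers⁺ : ∀ {x y} → P (proj₁ x) → P (proj₁ y) → proj₁ x ≢ proj₁ y → Covers weighted x y
  covers⁺ px py x≢y with complete L px | complete L py
  ... | k , refl | l , refl = (k , _) , (l , _) , refl , refl , x≢y ∘ cong (elem L)

  covers⁻ : ∀ {x y} → Covers weighted x y → P (proj₁ x) × P (proj₁ y) × proj₁ x ≢ proj₁ y
  covers⁻ ((k , _) , (l , _) , refl , refl , k≢l) = sound L k , sound L l , k≢l ∘ injective L

relist : {P Q : X → Set} → (∀ {a} → P a → Q a) → (∀ {a} → Q a → P a) → Listing K P → Listing K Q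
relist to from L = record
  { elem = elem L ; injective = injective L ; sound = to ∘ sound L ; complete = complete L ∘ from }

extend : ∀ {n} {P : X → Set} (a : X) → ¬ P a → Listing (Fin n) P → Listing (Fin (suc n)) (λ b → P b ⊎ a ≡ b)
extend {n = n} {P} a ¬pa L = record
  { elem = elem′ ; injective = injective′ ; sound = sound′ ; complete = complete′ }
  where
  elem′ : Fin (suc n) → _
  elem′ zero    = a
  elem′ (suc k) = elem L k
  injective′ : ∀ {k l} → elem′ k ≡ elem′ l → k ≡ l
  injective′ {zero}  {zero}  _  = refl
  injective′ {zero}  {suc l} eq = ⊥-elim (¬pa (subst P (sym eq) (sound L l)))
  injective′ {suc k} {zero}  eq = ⊥-elim (¬pa (subst P eq (sound L k)))
  injective′ {suc k} {suc l} eq = cong suc (injective L eq)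
  sound′ : ∀ k → P (elem′ k) ⊎ a ≡ elem′ k
  sound′ zero    = inj₂ refl
  sound′ (suc k) = inj₁ (sound L k)
  complete′ : ∀ {b} → P b ⊎ a ≡ b → ∃ λ k → elem′ k ≡ b
  complete′ (inj₂ refl) = zero , refl
  complete′ (inj₁ pb)   = let k , eq = complete L pb in suc k , eq

-- Each of the four groups of size t brings a slack of 1380 = 45 · 92 / 3: one is passed on, the other three
-- pay for the at most 92 lines of size 6, each of which is filled with the 45 blocks of design₆.
Pure Good Ample : ℕ → Set
Pure  m = Σ (GDD (Fin m)) λ D → singles (clusters D) ≡ 0
Good  m = Σ (GDD (Fin m)) λ D → singles (clusters D) ℕ.≤ m ℕ.* 300
Ample m = Σ (GDD (Fin m)) λ D → singles (clusters D) ℕ.+ 1380 ℕ.≤ m ℕ.* 300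

ample⇒good : ∀ {m} → Ample m → Good m
ample⇒good (D , b) = D , ℕ.m+n≤o⇒m≤o _ b

↔⇒injective : (X↔Y : X ↔ Y) → ∀ {x y} → Inverse.to X↔Y x ≡ Inverse.to X↔Y y → x ≡ y
↔⇒injective X↔Y {x} {y} eq = trans (sym (Inverse.strictlyInverseʳ X↔Y x))
  (trans (cong (Inverse.from X↔Y) eq) (Inverse.strictlyInverseʳ X↔Y y))

module _ (X↔Y : X ↔ Y) (D : GDD X) where

  private
    bijective : Listing X (λ (_ : Y) → ⊤)
    bijective = record
      { elem      = Inverse.to X↔Y
      ; injective = ↔⇒injective X↔Y
      ; sound     = _
      ; complete  = λ {b} _ → Inverse.from X↔Y b , Inverse.strictlyInverseˡ X↔Y b }

    relabelling : Piece (Y × Fin 3)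
    relabelling = weighted bijective D

  relabel : GDD Y
  relabel = union DifferentGroup (relabelling ∷ [])
    (λ x≢y → here (covers⁺ bijective D tt tt x≢y) [])
    (λ ¬x≢y → (λ c → ¬x≢y (proj₂ (proj₂ (covers⁻ bijective D c)))) ∷ [])

  singles-relabel : singles (clusters relabel) ≡ singles (clusters D)
  singles-relabel = trans (singles-union (relabelling ∷ [])) (ℕ.+-identityʳ _)

Σ↔sum : ∀ {n} (v : Vec ℕ n) → Σ (Fin n) (Fin ∘ lookup v) ↔ Fin (Vec.sum v)
Σ↔sum []      = mk↔ₛ′ (λ ()) (λ ()) (λ ()) (λ ())
Σ↔sum {suc n} (k ∷ v) = ↔-sym +↔⊎ ↔-∘ ((↔-refl ⊎-↔ Σ↔sum v) ↔-∘ split)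
  where
  to : Σ (Fin (suc n)) (Fin ∘ lookup (k ∷ v)) → Fin k ⊎ Σ (Fin n) (Fin ∘ lookup v)
  to (zero  , i) = inj₁ i
  to (suc g , i) = inj₂ (g , i)
  split : Σ (Fin (suc n)) (Fin ∘ lookup (k ∷ v)) ↔ (Fin k ⊎ Σ (Fin n) (Fin ∘ lookup v))
  split = mk↔ₛ′ to (λ { (inj₁ i) → zero , i ; (inj₂ (g , i)) → suc g , i })
    (λ { (inj₁ _) → refl ; (inj₂ _) → refl }) (λ { (zero , _) → refl ; (suc _ , _) → refl })

module TransversalDesign (t u w : ℕ) .{{_ : NonZero t}} (coprime : Coprime t 12)
                         (u≤t : u ℕ.≤ t) (w≤t : w ℕ.≤ t) where

  open Lines t coprime

  sizes : Vec ℕ 6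
  sizes = t ∷ t ∷ t ∷ t ∷ u ∷ w ∷ []

  sizes≤t : ∀ g → lookup sizes g ℕ.≤ t
  sizes≤t g = lookup⁺ {P = ℕ._≤ t} {xs = sizes} (ℕ.≤-refl ∷ ℕ.≤-refl ∷ ℕ.≤-refl ∷ ℕ.≤-refl ∷ u≤t ∷ w≤t ∷ []) g

  P : Set
  P = Σ (Fin 6) (Fin ∘ lookup sizes)

  group : P → Fin 6
  group = proj₁

  -- Truncation keeps the smallest residues, so a point of a short group is read as a point of the
  -- full one.
  coordinate : P → Fin t
  coordinate (g , i) = inject≤ i (sizes≤t g)

  point-injective : ∀ {a b} → group a ≡ group b → coordinate a ≡ coordinate b → a ≡ b
  point-injective {g , i} {.g , j} refl eq = cong (g ,_) (inject≤-injective (sizes≤t g) (sizes≤t g) i j eq)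

  OnLine : Fin t × Fin t → P → Set
  OnLine p a = coordinate a ≡ line (group a) p

  only : ∀ p {a b} → OnLine p a → OnLine p b → group a ≡ group b → a ≡ b
  only p on on′ eq = point-injective eq (trans on (trans (cong (λ g → line g p) eq) (sym on′)))

  module _ (p : Fin t × Fin t) where

    -- A line is listed group by group. A full group always adds one point, a truncated group at
    -- most one, so the number of points is known only after testing the last two groups.
    UpTo : ℕ → P → Set
    UpTo n a = OnLine p a × toℕ (group a) ℕ.< n

    none : Listing (Fin 0) (UpTo 0)
    none = record { elem = λ () ; injective = λ { {()} } ; sound = λ () ; complete = λ () }

    module _ (g : Fin 6) where

      narrow : ∀ {a} → group a ≢ g → UpTo (suc (toℕ g)) a → UpTo (toℕ g) a
      narrow ≢g (on , b) = on , ℕ.≤∧≢⇒< (ℕ.s≤s⁻¹ b) (≢g ∘ toℕ-injective)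

      widen : ∀ {a} → UpTo (toℕ g) a → UpTo (suc (toℕ g)) a
      widen (on , b) = on , ℕ.m<n⇒m<1+n b

      skip : ∀ {n} → (∀ i → ¬ OnLine p (g , i)) →
             Listing (Fin n) (UpTo (toℕ g)) → Listing (Fin n) (UpTo (suc (toℕ g)))
      skip off = relist widen (λ {a} (on , b) → narrow (λ { refl → off (proj₂ a) on }) (on , b))

      add : ∀ {n} i → OnLine p (g , i) →
            Listing (Fin n) (UpTo (toℕ g)) → Listing (Fin (suc n)) (UpTo (suc (toℕ g)))
      add i on L = relist
        (λ { (inj₁ up) → widen up ; (inj₂ refl) → on , ℕ.≤-refl })
        split
        (extend (g , i) (λ (_ , b) → ℕ.<-irrefl refl b) L)
        where
        split : ∀ {b} → UpTo (suc (toℕ g)) b → UpTo (toℕ g) b ⊎ (g , i) ≡ b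
        split {b} (on′ , b<) with group b Fin.≟ g
        ... | yes eq = inj₂ (only p on on′ (sym eq))
        ... | no ≢g  = inj₁ (narrow ≢g (on′ , b<))

      hit? : Dec (∃ λ i → OnLine p (g , i))
      hit? = any? (λ i → coordinate (g , i) Fin.≟ line g p)

    -- In a full group `coordinate` is the identity up to `inject≤`, so the residue `line g p` is
    -- itself the point of the line.
    full-points : Listing (Fin 4) (UpTo 4)
    full-points =
      add (# 3) (line (# 3) p) (inject≤-refl _ _) (add (# 2) (line (# 2) p) (inject≤-refl _ _)
        (add (# 1) (line (# 1) p) (inject≤-refl _ _) (add (# 0) (line (# 0) p) (inject≤-refl _ _) none)))

    everything : ∀ {n} → Listing (Fin n) (UpTo 6) → Listing (Fin n) (OnLine p)
    everything = relist proj₁ (λ {a} on → on , toℕ<n (group a))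

  GroupListing : ∀ g → Listing (Fin (lookup sizes g)) (λ a → group a ≡ g)
  GroupListing g = record
    { elem      = g ,_
    ; injective = λ { refl → refl }
    ; sound     = λ _ → refl
    ; complete  = λ { {_ , i} refl → i , refl } }

  Both : Fin t × Fin t → Set
  Both p = (∃ λ i → OnLine p (# 4 , i)) × (∃ λ j → OnLine p (# 5 , j))

  both? : ∀ p → Dec (Both p)
  both? p = hit? p (# 4) ×-dec hit? p (# 5)

  all-lines : List (Fin t × Fin t)
  all-lines = cartesianProduct (allFin t) (allFin t)

  all-lines-unique : Unique all-lines
  all-lines-unique = cartesianProduct⁺ (allFin⁺ t) (allFin⁺ t)

  -- A line is determined by its points in the last two groups, and there are `u * w` choices for
  -- these.
  few-long-lines : length (filter both? all-lines) ℕ.≤ u ℕ.* w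
  few-long-lines = begin
    length (filter both? all-lines)
      ≤⟨ unique-⊆⇒length-≤ (filter⁺ both? all-lines-unique)
           (λ {p} p∈ → joins p (proj₂ (∈-filter⁻ both? {xs = all-lines} p∈))) ⟩
    length (map join (cartesianProduct (allFin u) (allFin w)))
      ≡⟨ length-map join (cartesianProduct (allFin u) (allFin w)) ⟩
    length (cartesianProduct (allFin u) (allFin w))
      ≡⟨ length-cartesianProduct (allFin u) (allFin w) ⟩
    length (allFin u) ℕ.* length (allFin w)
      ≡⟨ cong₂ ℕ._*_ (length-tabulate {n = u} id) (length-tabulate {n = w} id) ⟩
    u ℕ.* w ∎
    where
    open ℕ.≤-Reasoning
    4≢5 : suc (suc (suc (suc zero))) ≢ suc (suc (suc (suc (suc (zero {0})))))
    4≢5 ()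
    joining : ∀ ij → ∃ λ p → line (# 4) p ≡ inject≤ (proj₁ ij) u≤t × line (# 5) p ≡ inject≤ (proj₂ ij) w≤t
    joining (i , j) = line-through 4≢5 (inject≤ i u≤t) (inject≤ j w≤t)
    join : Fin u × Fin w → Fin t × Fin t
    join ij = proj₁ (joining ij)
    joins : ∀ p → Both p → p ∈ map join (cartesianProduct (allFin u) (allFin w))
    joins p ((i , on) , (j , on′)) = subst (_∈ map join (cartesianProduct (allFin u) (allFin w)))
      (line-injective 4≢5 (trans (proj₁ (proj₂ (joining (i , j)))) on)
                          (trans (proj₂ (proj₂ (joining (i , j)))) on′))
      (∈-map⁺ join (∈-cartesianProduct⁺ (∈-allFin i) (∈-allFin j)))

  module _ (pure₄ : Pure 4) (pure₅ : Pure 5) (D₆ : GDD (Fin 6))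
           (groups : ∀ g → GDD (Fin (lookup sizes g))) where

    -- The final alternative is kept for the accounting: only a line that meets both truncated
    -- groups, and so has six points, brings blocks outside triangles.
    line-listing : ∀ p → ∃ λ n → Listing (Fin n) (OnLine p) × Σ (GDD (Fin n)) λ D →
                     singles (clusters D) ≡ 0 ⊎ Both p × singles (clusters D) ≡ singles (clusters D₆)
    line-listing p with hit? p (# 4) | hit? p (# 5)
    ... | yes (i , on) | yes (j , on′) =
      6 , everything p (add p (# 5) j on′ (add p (# 4) i on (full-points p))) ,
      D₆ , inj₂ (((i , on) , (j , on′)) , refl)
    ... | yes (i , on) | no off        =
      5 , everything p (skip p (# 5) (λ j on → off (j , on)) (add p (# 4) i on (full-points p))) ,
      proj₁ pure₅ , inj₁ (proj₂ pure₅)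
    ... | no off       | yes (j , on)  =
      5 , everything p (add p (# 5) j on (skip p (# 4) (λ i on → off (i , on)) (full-points p))) ,
      proj₁ pure₅ , inj₁ (proj₂ pure₅)
    ... | no off       | no off′       =
      4 , everything p (skip p (# 5) (λ j on → off′ (j , on))
                         (skip p (# 4) (λ i on → off (i , on)) (full-points p))) ,
      proj₁ pure₄ , inj₁ (proj₂ pure₄)

    line-piece : Fin t × Fin t → Piece (P × Fin 3)
    line-piece p = let _ , L , D , _ = line-listing p in weighted L D

    line-covers⁺ : ∀ p {x y} → OnLine p (proj₁ x) → OnLine p (proj₁ y) → proj₁ x ≢ proj₁ y →
                   Covers (line-piece p) x y
    line-covers⁺ p = let _ , L , D , _ = line-listing p in covers⁺ L D

    line-covers⁻ : ∀ p {x y} → Covers (line-piece p) x y →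
                   OnLine p (proj₁ x) × OnLine p (proj₁ y) × proj₁ x ≢ proj₁ y
    line-covers⁻ p = let _ , L , D , _ = line-listing p in covers⁻ L D

    group-piece : Fin 6 → Piece (P × Fin 3)
    group-piece g = weighted (GroupListing g) (groups g)

    line-pieces group-pieces pieces : List (Piece (P × Fin 3))
    line-pieces  = map line-piece all-lines
    group-pieces = map group-piece (allFin 6)
    pieces       = line-pieces ++ group-pieces

    lines-avoid : ∀ {x y} → (∀ p → ¬ Covers (line-piece p) x y) → None (λ q → Covers q x y) line-pieces
    lines-avoid ¬c = All.map⁺ (All.universal ¬c all-lines)

    groups-avoid : ∀ {x y} → (∀ g → ¬ Covers (group-piece g) x y) → None (λ q → Covers q x y) group-pieces
    groups-avoid ¬c = All.map⁺ {f = group-piece} (All.universal ¬c (allFin 6))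

    -- A line has at most one point in each group of the transversal design, so a pair inside such a
    -- group is left to the design on that group. A pair from two groups lies on exactly one line.
    pieces-cover : ∀ {x y} → DifferentGroup x y → One (λ q → Covers q x y) pieces
    pieces-cover {x} {y} x≢y with group (proj₁ x) Fin.≟ group (proj₁ y)
    ... | yes eq = one-++ʳ
      (lines-avoid λ p c → let on , on′ , _ = line-covers⁻ p c in x≢y (only p on on′ eq))
      (one-map⁺ {f = group-piece} (unique⇒one (allFin⁺ 6) (∈-allFin (group (proj₁ y)))
        (covers⁺ (GroupListing (group (proj₁ y))) (groups (group (proj₁ y))) eq refl x≢y)
        (λ {g} c → sym (proj₁ (proj₂ (covers⁻ (GroupListing g) (groups g) c))))))
    ... | no ≢g = let p , on , on′ = line-through ≢g (coordinate (proj₁ x)) (coordinate (proj₁ y)) in one-++ˡ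
      (one-map⁺ (unique⇒one all-lines-unique (∈-cartesianProduct⁺ (∈-allFin (proj₁ p)) (∈-allFin (proj₂ p)))
        (line-covers⁺ p (sym on) (sym on′) x≢y)
        (λ {q} c → let on₁ , on₁′ , _ = line-covers⁻ q c in
          line-injective ≢g (trans (sym on₁) (sym on)) (trans (sym on₁′) (sym on′)))))
      (groups-avoid λ g c →
        let eq , eq′ , _ = covers⁻ (GroupListing g) (groups g) c in ≢g (trans eq (sym eq′)))

    pieces-avoid : ∀ {x y} → ¬ DifferentGroup x y → None (λ q → Covers q x y) pieces
    pieces-avoid ¬# = All.++⁺
      (lines-avoid λ p c → ¬# (proj₂ (proj₂ (line-covers⁻ p c))))
      (groups-avoid λ g c → ¬# (proj₂ (proj₂ (covers⁻ (GroupListing g) (groups g) c))))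

    filled : GDD P
    filled = union DifferentGroup pieces pieces-cover pieces-avoid

    long-excess : ∀ p → excess (line-piece p) ℕ.≤ singles (clusters D₆)
    long-excess p with proj₂ (proj₂ (proj₂ (line-listing p)))
    ... | inj₁ eq       = ℕ.≤-trans (ℕ.≤-reflexive eq) z≤n
    ... | inj₂ (_ , eq) = ℕ.≤-reflexive eq

    short-excess : ∀ p → ¬ Both p → excess (line-piece p) ≡ 0
    short-excess p ¬both with proj₂ (proj₂ (proj₂ (line-listing p)))
    ... | inj₁ eq         = eq
    ... | inj₂ (both , _) = ⊥-elim (¬both both)

    line-excess : ∀ ps → sum (map excess (map line-piece ps)) ℕ.≤
                  singles (clusters D₆) ℕ.* length (filter both? ps)
    line-excess []       = z≤n
    line-excess (p ∷ ps) = cons (both? p)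
      where
      open ℕ.≤-Reasoning
      cons : Dec (Both p) → excess (line-piece p) ℕ.+ sum (map excess (map line-piece ps)) ℕ.≤
                            singles (clusters D₆) ℕ.* length (filter both? (p ∷ ps))
      cons (yes both) = begin
        excess (line-piece p) ℕ.+ sum (map excess (map line-piece ps))
          ≤⟨ ℕ.+-mono-≤ (long-excess p) (line-excess ps) ⟩
        singles (clusters D₆) ℕ.+ singles (clusters D₆) ℕ.* length (filter both? ps)
          ≡⟨ ℕ.*-suc (singles (clusters D₆)) _ ⟨
        singles (clusters D₆) ℕ.* suc (length (filter both? ps))
          ≡⟨ cong (λ qs → singles (clusters D₆) ℕ.* length qs) (filter-accept both? both) ⟨
        singles (clusters D₆) ℕ.* length (filter both? (p ∷ ps)) ∎
      cons (no ¬both) = begin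
        excess (line-piece p) ℕ.+ sum (map excess (map line-piece ps))
          ≤⟨ ℕ.+-mono-≤ (ℕ.≤-reflexive (short-excess p ¬both)) (line-excess ps) ⟩
        singles (clusters D₆) ℕ.* length (filter both? ps)
          ≡⟨ cong (λ qs → singles (clusters D₆) ℕ.* length qs) (filter-reject both? ¬both) ⟨
        singles (clusters D₆) ℕ.* length (filter both? (p ∷ ps)) ∎

    singles-filled : singles (clusters filled) ℕ.≤
                     singles (clusters D₆) ℕ.* (u ℕ.* w) ℕ.+
                     sum (map (singles ∘ clusters ∘ groups) (allFin 6))
    singles-filled = begin
      singles (clusters filled)
        ≡⟨ singles-union pieces ⟩
      sum (map excess pieces)
        ≡⟨ cong sum (map-++ excess line-pieces group-pieces) ⟩
      sum (map excess line-pieces ++ map excess group-pieces)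
        ≡⟨ sum-++ (map excess line-pieces) (map excess group-pieces) ⟩
      sum (map excess line-pieces) ℕ.+ sum (map excess group-pieces)
        ≤⟨ ℕ.+-monoˡ-≤ (sum (map excess group-pieces))
             (ℕ.≤-trans (line-excess all-lines) (ℕ.*-monoʳ-≤ (singles (clusters D₆)) few-long-lines)) ⟩
      singles (clusters D₆) ℕ.* (u ℕ.* w) ℕ.+ sum (map excess group-pieces) ∎
      where open ℕ.≤-Reasoning

accounting : ∀ k e t u w {s l a b c} →
             s ℕ.≤ l ℕ.+ (a ℕ.+ (a ℕ.+ (a ℕ.+ (a ℕ.+ (b ℕ.+ (c ℕ.+ 0)))))) → l ℕ.≤ 3 ℕ.* e →
             a ℕ.+ e ℕ.≤ t ℕ.* k → b ℕ.≤ u ℕ.* k → c ℕ.≤ w ℕ.* k →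
             s ℕ.+ e ℕ.≤ (t ℕ.+ (t ℕ.+ (t ℕ.+ (t ℕ.+ (u ℕ.+ (w ℕ.+ 0)))))) ℕ.* k
accounting k e t u w {s} {l} {a} {b} {c} s≤ l≤ a≤ b≤ c≤ = begin
  s ℕ.+ e
    ≤⟨ ℕ.+-monoˡ-≤ e (ℕ.≤-trans s≤ (ℕ.+-monoˡ-≤ _ l≤)) ⟩
  3 ℕ.* e ℕ.+ (a ℕ.+ (a ℕ.+ (a ℕ.+ (a ℕ.+ (b ℕ.+ (c ℕ.+ 0)))))) ℕ.+ e
    ≡⟨ regroup e a b c ⟩
  (a ℕ.+ e) ℕ.+ ((a ℕ.+ e) ℕ.+ ((a ℕ.+ e) ℕ.+ ((a ℕ.+ e) ℕ.+ (b ℕ.+ c))))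
    ≤⟨ ℕ.+-mono-≤ a≤ (ℕ.+-mono-≤ a≤ (ℕ.+-mono-≤ a≤ (ℕ.+-mono-≤ a≤ (ℕ.+-mono-≤ b≤ c≤)))) ⟩
  t ℕ.* k ℕ.+ (t ℕ.* k ℕ.+ (t ℕ.* k ℕ.+ (t ℕ.* k ℕ.+ (u ℕ.* k ℕ.+ w ℕ.* k))))
    ≡⟨ distrib k t u w ⟩
  (t ℕ.+ (t ℕ.+ (t ℕ.+ (t ℕ.+ (u ℕ.+ (w ℕ.+ 0)))))) ℕ.* k ∎
  where
  open ℕ.≤-Reasoning
  regroup : ∀ e a b c → 3 ℕ.* e ℕ.+ (a ℕ.+ (a ℕ.+ (a ℕ.+ (a ℕ.+ (b ℕ.+ (c ℕ.+ 0)))))) ℕ.+ e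
            ≡ (a ℕ.+ e) ℕ.+ ((a ℕ.+ e) ℕ.+ ((a ℕ.+ e) ℕ.+ ((a ℕ.+ e) ℕ.+ (b ℕ.+ c))))
  regroup = solve-∀-ℕ
  distrib : ∀ k t u w → t ℕ.* k ℕ.+ (t ℕ.* k ℕ.+ (t ℕ.* k ℕ.+ (t ℕ.* k ℕ.+ (u ℕ.* k ℕ.+ w ℕ.* k))))
                        ≡ (t ℕ.+ (t ℕ.+ (t ℕ.+ (t ℕ.+ (u ℕ.+ (w ℕ.+ 0)))))) ℕ.* k
  distrib = solve-∀-ℕ

module _ (pure₄ : Pure 4) (pure₅ : Pure 5) (D₆ : GDD (Fin 6))
         (singles-D₆ : singles (clusters D₆) ℕ.≤ 45) where

  fill-transversal : ∀ t u w .{{_ : NonZero t}} → Coprime t 12 → u ℕ.≤ t → w ℕ.≤ t → u ℕ.* w ℕ.≤ 92 →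
                Ample t → Good u → Good w → Ample (4 ℕ.* t ℕ.+ (u ℕ.+ w))
  fill-transversal t u w coprime u≤t w≤t uw≤92 (Dₜ , bₜ) (Dᵤ , bᵤ) (D_w , b_w) =
    subst Ample (ring t u w)
      (relabel (Σ↔sum sizes) D ,
       ℕ.≤-trans (ℕ.≤-reflexive (cong (ℕ._+ 1380) (singles-relabel (Σ↔sum sizes) D))) bound)
    where
    open TransversalDesign t u w coprime u≤t w≤t
    groups : ∀ g → GDD (Fin (lookup sizes g))
    groups zero                                   = Dₜ
    groups (suc zero)                             = Dₜ
    groups (suc (suc zero))                       = Dₜ
    groups (suc (suc (suc zero)))                 = Dₜ
    groups (suc (suc (suc (suc zero))))           = Dᵤ
    groups (suc (suc (suc (suc (suc zero)))))     = D_w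
    D : GDD P
    D = filled pure₄ pure₅ D₆ groups
    ring : ∀ t u w → t ℕ.+ (t ℕ.+ (t ℕ.+ (t ℕ.+ (u ℕ.+ (w ℕ.+ 0))))) ≡ 4 ℕ.* t ℕ.+ (u ℕ.+ w)
    ring = solve-∀-ℕ
    bound : singles (clusters D) ℕ.+ 1380 ℕ.≤ Vec.sum sizes ℕ.* 300
    bound = accounting 300 1380 t u w (singles-filled pure₄ pure₅ D₆ groups)
              (ℕ.*-mono-≤ singles-D₆ uw≤92) bₜ bᵤ b_w

-- Difference families over ℤₖ × ℤ₃

module _ (k : ℕ) .{{_ : NonZero k}} where

  Congruent : ℕ → ℕ → Set
  Congruent a b = a % k ≡ b % k

  congruent-+ : ∀ {a b c d} → Congruent a b → Congruent c d → Congruent (a ℕ.+ c) (b ℕ.+ d)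
  congruent-+ {a} {b} {c} {d} p q =
    trans (%-distribˡ-+ a c k) (trans (cong₂ (λ x y → (x ℕ.+ y) % k) p q) (sym (%-distribˡ-+ b d k)))

  -- For a multiple of `k` the value is `k` rather than 0; only its residue matters.
  negate : ℕ → ℕ
  negate s = k ℕ.∸ s % k

  negate-inverse : ∀ a s → Congruent (a ℕ.+ (s ℕ.+ negate s)) a
  negate-inverse a s = trans (cong (λ x → (a ℕ.+ x) % k) multiple) ([m+kn]%n≡m%n a (suc (s ℕ./ k)) k)
    where
    open ≡-Reasoning
    multiple : s ℕ.+ negate s ≡ suc (s ℕ./ k) ℕ.* k
    multiple = begin
      s ℕ.+ negate s
        ≡⟨ cong (ℕ._+ negate s) (trans (m≡m%n+[m/n]*n s k) (ℕ.+-comm (s % k) _)) ⟩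
      s ℕ./ k ℕ.* k ℕ.+ s % k ℕ.+ (k ℕ.∸ s % k)        ≡⟨ ℕ.+-assoc (s ℕ./ k ℕ.* k) (s % k) _ ⟩
      s ℕ./ k ℕ.* k ℕ.+ (s % k ℕ.+ (k ℕ.∸ s % k))
        ≡⟨ cong (s ℕ./ k ℕ.* k ℕ.+_) (ℕ.m+[n∸m]≡n (m%n≤n s k)) ⟩
      s ℕ./ k ℕ.* k ℕ.+ k                            ≡⟨ ℕ.+-comm _ k ⟩
      suc (s ℕ./ k) ℕ.* k ∎

  congruent-cancelʳ : ∀ {a b} s → Congruent (a ℕ.+ s) (b ℕ.+ s) → Congruent a b
  congruent-cancelʳ {a} {b} s eq = trans (sym (undo a))
    (trans (congruent-+ {a ℕ.+ s} {b ℕ.+ s} {negate s} eq refl) (undo b))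
    where undo : ∀ a → Congruent (a ℕ.+ s ℕ.+ negate s) a
          undo a = trans (cong (_% k) (ℕ.+-assoc a s _)) (negate-inverse a s)

  translate : ℕ → ℕ → Fin k
  translate s x = (x ℕ.+ s) mod k

  toℕ-mod : ∀ a → toℕ (a mod k) ≡ a % k
  toℕ-mod a = toℕ-fromℕ< (m%n<n a k)

  translate-≡⁻ : ∀ s x {X} → translate s x ≡ X → Congruent (x ℕ.+ s) (toℕ X)
  translate-≡⁻ s x refl = sym (trans (cong (_% k) (toℕ-mod (x ℕ.+ s))) (m%n%n≡m%n (x ℕ.+ s) k))

  translate-≡⁺ : ∀ s x X → Congruent (x ℕ.+ s) (toℕ X) → translate s x ≡ X
  translate-≡⁺ s x X eq = toℕ-injective (trans (toℕ-mod (x ℕ.+ s)) (trans eq (m<n⇒m%n≡m (toℕ<n X))))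

  translation : ∀ x X → ∃ λ (s : Fin k) → translate (toℕ s) x ≡ X
  translation x X = s , translate-≡⁺ (toℕ s) x X (trans (congruent-+ {x} {x} refl reduce)
    (trans (cong (_% k) (ring x (negate x) (toℕ X))) (negate-inverse (toℕ X) x)))
    where
    s : Fin k
    s = (negate x ℕ.+ toℕ X) mod k
    reduce : Congruent (toℕ s) (negate x ℕ.+ toℕ X)
    reduce = trans (cong (_% k) (toℕ-mod (negate x ℕ.+ toℕ X))) (m%n%n≡m%n (negate x ℕ.+ toℕ X) k)
    ring : ∀ x n X → x ℕ.+ (n ℕ.+ X) ≡ X ℕ.+ (x ℕ.+ n)
    ring x n X = trans (sym (ℕ.+-assoc x n X)) (ℕ.+-comm (x ℕ.+ n) X)

  translation-unique : ∀ x (s s′ : Fin k) → translate (toℕ s) x ≡ translate (toℕ s′) x → s ≡ s′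
  translation-unique x s s′ eq = toℕ-injective
    (trans (sym (m<n⇒m%n≡m (toℕ<n s)))
      (trans (congruent-cancelʳ {toℕ s} {toℕ s′} x same) (m<n⇒m%n≡m (toℕ<n s′))))
    where
    same : Congruent (toℕ s ℕ.+ x) (toℕ s′ ℕ.+ x)
    same = begin
      (toℕ s ℕ.+ x) % k      ≡⟨ cong (_% k) (ℕ.+-comm (toℕ s) x) ⟩
      (x ℕ.+ toℕ s) % k      ≡⟨ toℕ-mod (x ℕ.+ toℕ s) ⟨
      toℕ (translate (toℕ s) x)   ≡⟨ cong toℕ eq ⟩
      toℕ (translate (toℕ s′) x)  ≡⟨ toℕ-mod (x ℕ.+ toℕ s′) ⟩
      (x ℕ.+ toℕ s′) % k     ≡⟨ cong (_% k) (ℕ.+-comm x (toℕ s′)) ⟩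
      (toℕ s′ ℕ.+ x) % k ∎
      where open ≡-Reasoning

  -- Translation preserves differences: once `x` is sent to `X`, agreement of the differences sends
  -- `y` to `Y`. The converse is `difference⁻`.
  difference⁺ : ∀ x y s d {X Y} → translate s x ≡ X → Congruent (toℕ X ℕ.+ d) (toℕ Y) →
                Congruent (x ℕ.+ d) y → translate s y ≡ Y
  difference⁺ x y s d {X} {Y} eq dXY dxy = translate-≡⁺ s y Y (begin
    (y ℕ.+ s) % k          ≡⟨ congruent-+ {y} {x ℕ.+ d} {s} (sym dxy) refl ⟩
    (x ℕ.+ d ℕ.+ s) % k      ≡⟨ cong (_% k) (ring x d s) ⟩
    (x ℕ.+ s ℕ.+ d) % k      ≡⟨ congruent-+ {x ℕ.+ s} {toℕ X} {d} (translate-≡⁻ s x eq) refl ⟩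
    (toℕ X ℕ.+ d) % k      ≡⟨ dXY ⟩
    toℕ Y % k ∎)
    where
    open ≡-Reasoning
    ring : ∀ x d s → x ℕ.+ d ℕ.+ s ≡ x ℕ.+ s ℕ.+ d
    ring x d s = trans (ℕ.+-assoc x d s) (trans (cong (x ℕ.+_) (ℕ.+-comm d s)) (sym (ℕ.+-assoc x s d)))

  difference⁻ : ∀ x y s d {X Y} → translate s x ≡ X → Congruent (toℕ X ℕ.+ d) (toℕ Y) →
                translate s y ≡ Y → Congruent (x ℕ.+ d) y
  difference⁻ x y s d {X} {Y} eq dXY eq′ = congruent-cancelʳ {x ℕ.+ d} {y} s (begin
    (x ℕ.+ d ℕ.+ s) % k      ≡⟨ cong (_% k) (ring x d s) ⟩
    (x ℕ.+ s ℕ.+ d) % k      ≡⟨ congruent-+ {x ℕ.+ s} {toℕ X} {d} (translate-≡⁻ s x eq) refl ⟩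
    (toℕ X ℕ.+ d) % k      ≡⟨ dXY ⟩
    toℕ Y % k            ≡⟨ sym (translate-≡⁻ s y eq′) ⟩
    (y ℕ.+ s) % k ∎)
    where
    open ≡-Reasoning
    ring : ∀ x d s → x ℕ.+ d ℕ.+ s ≡ x ℕ.+ s ℕ.+ d
    ring x d s = trans (ℕ.+-assoc x d s) (trans (cong (x ℕ.+_) (ℕ.+-comm d s)) (sym (ℕ.+-assoc x s d)))

module Development (k : ℕ) .{{_ : NonZero k}} (base : List (Cluster (ℕ × ℕ))) where

  HasDifference : ℕ → ℕ → (ℕ × ℕ) × (ℕ × ℕ) → Set
  HasDifference d e ((x , a) , (y , b)) = Congruent k (x ℕ.+ d) y × Congruent 3 (a ℕ.+ e) b

  hasDifference? : ∀ d e p → Dec (HasDifference d e p)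
  hasDifference? d e ((x , a) , (y , b)) = ((x ℕ.+ d) % k ℕ.≟ y % k) ×-dec ((a ℕ.+ e) % 3 ℕ.≟ b % 3)

  -- First component 0 means two points of the same group of the developed design, whatever the
  -- second component is.
  DifferenceFamily : Set
  DifferenceFamily = ∀ (d : Fin k) (e : Fin 3) →
    (toℕ d ≢ 0 → One  (HasDifference (toℕ d) (toℕ e)) (pairsOf base)) ×
    (toℕ d ≡ 0 → None (HasDifference (toℕ d) (toℕ e)) (pairsOf base))

  differenceFamily? : Dec DifferenceFamily
  differenceFamily? = all? λ d → all? λ e →
    (¬? (toℕ d ℕ.≟ 0) →-dec one? (hasDifference? (toℕ d) (toℕ e)) (pairsOf base)) ×-dec
    ((toℕ d ℕ.≟ 0) →-dec All.all? (¬? ∘ hasDifference? (toℕ d) (toℕ e)) (pairsOf base))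

  shift : Fin k × Fin 3 → ℕ × ℕ → Fin k × Fin 3
  shift (s , r) (x , a) = translate k (toℕ s) x , translate 3 (toℕ r) a

  shifts : List (Fin k × Fin 3)
  shifts = cartesianProduct (allFin k) (allFin 3)

  orbit : Cluster (ℕ × ℕ) → List (Cluster (Fin k × Fin 3))
  orbit c = map (λ σ → mapCluster (shift σ) c) shifts

  orbitPairs : ∀ c → pairsOf (orbit c) ≡ concatMap (λ σ → map (mapPair (shift σ)) (clusterPairs c)) shifts
  orbitPairs c = trans (concatMap-map clusterPairs (λ σ → mapCluster (shift σ) c) shifts)
                       (concatMap-cong (λ σ → clusterPairs-map (shift σ) c) shifts)

  module _ (X Y : Fin k × Fin 3) where

    d : Fin k
    d = proj₁ (translation k (toℕ (proj₁ X)) (proj₁ Y))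
    e : Fin 3
    e = proj₁ (translation 3 (toℕ (proj₂ X)) (proj₂ Y))
    dXY : Congruent k (toℕ (proj₁ X) ℕ.+ toℕ d) (toℕ (proj₁ Y))
    dXY = translate-≡⁻ k (toℕ d) (toℕ (proj₁ X)) (proj₂ (translation k (toℕ (proj₁ X)) (proj₁ Y)))
    eXY : Congruent 3 (toℕ (proj₂ X) ℕ.+ toℕ e) (toℕ (proj₂ Y))
    eXY = translate-≡⁻ 3 (toℕ e) (toℕ (proj₂ X)) (proj₂ (translation 3 (toℕ (proj₂ X)) (proj₂ Y)))

    Match : (ℕ × ℕ) × (ℕ × ℕ) → Set
    Match = HasDifference (toℕ d) (toℕ e)

    hit⇒match : ∀ σ p → (X , Y) ≡ mapPair (shift σ) p → Match p
    hit⇒match (s , r) ((x , a) , (y , b)) refl =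
      difference⁻ k x y (toℕ s) (toℕ d) refl dXY refl , difference⁻ 3 a b (toℕ r) (toℕ e) refl eXY refl

    orbit-never : ∀ c → None Match (clusterPairs c) → None ((X , Y) ≡_) (pairsOf (orbit c))
    orbit-never c n = subst (None _) (sym (orbitPairs c))
      (none-concatMap⁺ (λ _ → ⊥) (λ _ ())
        (λ σ _ → All.map⁺ (All.map (λ {p} ¬m hit → ¬m (hit⇒match σ p hit)) n))
        (All.universal (λ _ ()) shifts))

    -- The only pair of the cluster with the right difference is carried to `(X , Y)` by a single
    -- translation `σ₀`. Any other hit would come from a pair with the same difference, hence from
    -- the same pair, and then from the same translation.
    orbit-once : ∀ c → One Match (clusterPairs c) → One ((X , Y) ≡_) (pairsOf (orbit c))
    orbit-once c o with one-witness o
    ... | ((x , a) , (y , b)) , p∈ , m , m′ =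
      subst (One _) (sym (orbitPairs c))
        (one-concatMap⁺ (_≡ σ₀) some none (unique⇒one (cartesianProduct⁺ (allFin⁺ k) (allFin⁺ 3))
           (∈-cartesianProduct⁺ (∈-allFin _) (∈-allFin _)) refl id))
      where
      σ₀ : Fin k × Fin 3
      σ₀ = proj₁ (translation k x (proj₁ X)) , proj₁ (translation 3 a (proj₂ X))
      σ₀x : shift σ₀ (x , a) ≡ X
      σ₀x = cong₂ _,_ (proj₂ (translation k x (proj₁ X))) (proj₂ (translation 3 a (proj₂ X)))
      σ₀y : shift σ₀ (y , b) ≡ Y
      σ₀y = cong₂ _,_
        (difference⁺ k x y (toℕ (proj₁ σ₀)) (toℕ d) (cong proj₁ σ₀x) dXY m)
        (difference⁺ 3 a b (toℕ (proj₂ σ₀)) (toℕ e) (cong proj₂ σ₀x) eXY m′)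
      some : ∀ σ → σ ≡ σ₀ → One ((X , Y) ≡_) (map (mapPair (shift σ)) (clusterPairs c))
      some _ refl = one-map⁺ (one-cong
        (λ q∈ mq → trans (sym (cong₂ _,_ σ₀x σ₀y))
                         (cong (mapPair (shift σ₀)) (one-unique o p∈ (m , m′) q∈ mq)))
        (λ {q} _ hit → hit⇒match σ₀ q hit) o)
      none : ∀ σ → σ ≢ σ₀ → None ((X , Y) ≡_) (map (mapPair (shift σ)) (clusterPairs c))
      none σ σ≢ = All.map⁺ (All.tabulate λ {q} q∈ hit →
        σ≢ (same q hit (one-unique o q∈ (hit⇒match σ q hit) p∈ (m , m′))))
        where
        same : ∀ q → (X , Y) ≡ mapPair (shift σ) q → q ≡ ((x , a) , (y , b)) → σ ≡ σ₀
        same _ hit refl = cong₂ _,_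
          (translation-unique k x (proj₁ σ) (proj₁ σ₀)
            (trans (sym (cong (proj₁ ∘ proj₁) hit)) (sym (cong proj₁ σ₀x))))
          (translation-unique 3 a (proj₂ σ) (proj₂ σ₀)
            (trans (sym (cong (proj₂ ∘ proj₁) hit)) (sym (cong proj₂ σ₀x))))

  developed : List (Cluster (Fin k × Fin 3))
  developed = concatMap orbit base

  development : DifferenceFamily → All Triangle base → GDD (Fin k)
  development family triangular = record
    { clusters  = developed
    ; triangles = All.concat⁺ (All.map⁺ (All.map
        (λ {c} t → All.map⁺ (All.universal (λ σ → triangle-map (shift σ) {c} t) shifts)) triangular))
    ; once      = λ {X} {Y} X≢Y → subst (One _) (sym (pairsOf-concatMap orbit base))
        (one-transfer (orbit-once X Y) (orbit-never X Y) base
          (proj₁ (family (d X Y) (e X Y)) (X≢Y ∘ zero-difference⁻ X Y)))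
    ; never     = λ {X} {Y} ¬X≢Y → subst (None _) (sym (pairsOf-concatMap orbit base))
        (none-transfer (orbit-once X Y) (orbit-never X Y) base
          (proj₂ (family (d X Y) (e X Y))
            (zero-difference⁺ X Y (decidable-stable (proj₁ X Fin.≟ proj₁ Y) ¬X≢Y)))) }
    where
    zero-difference⁻ : ∀ X Y → toℕ (d X Y) ≡ 0 → proj₁ X ≡ proj₁ Y
    zero-difference⁻ X Y eq = toℕ-injective (begin
      toℕ (proj₁ X)                         ≡⟨ m<n⇒m%n≡m (toℕ<n (proj₁ X)) ⟨
      toℕ (proj₁ X) % k                     ≡⟨ cong (_% k) (ℕ.+-identityʳ (toℕ (proj₁ X))) ⟨
      (toℕ (proj₁ X) ℕ.+ 0) % k               ≡⟨ cong (λ z → (toℕ (proj₁ X) ℕ.+ z) % k) eq ⟨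
      (toℕ (proj₁ X) ℕ.+ toℕ (d X Y)) % k     ≡⟨ dXY X Y ⟩
      toℕ (proj₁ Y) % k                     ≡⟨ m<n⇒m%n≡m (toℕ<n (proj₁ Y)) ⟩
      toℕ (proj₁ Y) ∎)
      where open ≡-Reasoning
    zero-difference⁺ : ∀ X Y → proj₁ X ≡ proj₁ Y → toℕ (d X Y) ≡ 0
    zero-difference⁺ X Y eq = begin
      toℕ (d X Y)                           ≡⟨ m<n⇒m%n≡m (toℕ<n (d X Y)) ⟨
      toℕ (d X Y) % k
        ≡⟨ congruent-cancelʳ k {toℕ (d X Y)} {0} (toℕ (proj₁ X)) same ⟩
      0 % k                                 ≡⟨ m<n⇒m%n≡m (ℕ.>-nonZero⁻¹ k) ⟩
      0 ∎
      where
      open ≡-Reasoning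
      same : Congruent k (toℕ (d X Y) ℕ.+ toℕ (proj₁ X)) (toℕ (proj₁ X))
      same = trans (cong (_% k) (ℕ.+-comm (toℕ (d X Y)) (toℕ (proj₁ X))))
        (trans (dXY X Y) (cong (λ z → toℕ z % k) (sym eq)))

pattern ⟨_,_,_,_⟩ a b c d = a ∷ b ∷ c ∷ d ∷ []

module _ (k : ℕ) .{{_ : NonZero k}} (base : List (Vec ℕ 4)) where

  -- The code 3 x + a stands for the element (x , a) of ℤₖ × ℤ₃.
  decoded : List (Cluster (ℕ × ℕ))
  decoded = map (one ∘ Vec.map λ c → c ℕ./ 3 , c % 3) base

  open Development k decoded

  -- All developed blocks count as lying outside triangles. Only finitely many orders arise here,
  -- and for each of them the bound `k * 300` leaves room for these blocks and the slack.
  cyclic : True differenceFamily? → True (singles developed ℕ.+ 1380 ℕ.≤? k ℕ.* 300) → Ample k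
  cyclic family bound = development (toWitness family) (All.map⁺ (All.universal _ base)) , toWitness bound

-- These families, like the base blocks of pure₄, pure₅ and design₆, were found by computer search.
ample₇ : Ample 7
ample₇ = cyclic 7
  ( ⟨ 0 , 4 , 19 , 6 ⟩  ∷ ⟨ 0 , 20 , 8 , 12 ⟩  ∷ ⟨ 0 , 13 , 10 , 3 ⟩
  ∷ []) _ _

ample₁₁ : Ample 11
ample₁₁ = cyclic 11
  ( ⟨ 0 , 9 , 32 , 4 ⟩  ∷ ⟨ 0 , 15 , 13 , 20 ⟩  ∷ ⟨ 0 , 6 , 27 , 18 ⟩
  ∷ ⟨ 0 , 16 , 26 , 19 ⟩  ∷ ⟨ 0 , 11 , 25 , 22 ⟩
  ∷ []) _ _

ample₁₃ : Ample 13
ample₁₃ = cyclic 13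
  ( ⟨ 0 , 24 , 4 , 15 ⟩  ∷ ⟨ 0 , 35 , 9 , 38 ⟩  ∷ ⟨ 0 , 23 , 6 , 17 ⟩
  ∷ ⟨ 0 , 37 , 5 , 26 ⟩  ∷ ⟨ 0 , 18 , 13 , 10 ⟩  ∷ ⟨ 0 , 8 , 27 , 20 ⟩
  ∷ []) _ _

ample₁₇ : Ample 17
ample₁₇ = cyclic 17
  ( ⟨ 0 , 28 , 35 , 47 ⟩  ∷ ⟨ 0 , 33 , 3 , 26 ⟩  ∷ ⟨ 0 , 9 , 27 , 22 ⟩
  ∷ ⟨ 0 , 25 , 39 , 29 ⟩  ∷ ⟨ 0 , 8 , 36 , 15 ⟩  ∷ ⟨ 0 , 37 , 43 , 34 ⟩
  ∷ ⟨ 0 , 20 , 16 , 14 ⟩  ∷ ⟨ 0 , 38 , 11 , 40 ⟩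
  ∷ []) _ _

ample₁₉ : Ample 19
ample₁₉ = cyclic 19
  ( ⟨ 0 , 31 , 50 , 51 ⟩  ∷ ⟨ 0 , 54 , 22 , 35 ⟩  ∷ ⟨ 0 , 7 , 24 , 10 ⟩
  ∷ ⟨ 0 , 40 , 12 , 45 ⟩  ∷ ⟨ 0 , 18 , 17 , 9 ⟩  ∷ ⟨ 0 , 30 , 46 , 15 ⟩
  ∷ ⟨ 0 , 44 , 26 , 37 ⟩  ∷ ⟨ 0 , 28 , 55 , 34 ⟩  ∷ ⟨ 0 , 41 , 5 , 49 ⟩
  ∷ []) _ _

ample₂₃ : Ample 23
ample₂₃ = cyclic 23
  ( ⟨ 0 , 59 , 36 , 14 ⟩  ∷ ⟨ 0 , 40 , 23 , 37 ⟩  ∷ ⟨ 0 , 63 , 61 , 68 ⟩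
  ∷ ⟨ 0 , 31 , 34 , 64 ⟩  ∷ ⟨ 0 , 41 , 58 , 51 ⟩  ∷ ⟨ 0 , 21 , 43 , 29 ⟩
  ∷ ⟨ 0 , 19 , 28 , 60 ⟩  ∷ ⟨ 0 , 48 , 4 , 54 ⟩  ∷ ⟨ 0 , 15 , 57 , 27 ⟩
  ∷ ⟨ 0 , 16 , 45 , 26 ⟩  ∷ ⟨ 0 , 62 , 11 , 46 ⟩
  ∷ []) _ _

ample₃₁ : Ample 31
ample₃₁ = cyclic 31
  ( ⟨ 0 , 67 , 60 , 30 ⟩  ∷ ⟨ 0 , 22 , 92 , 86 ⟩  ∷ ⟨ 0 , 90 , 5 , 16 ⟩
  ∷ ⟨ 0 , 55 , 47 , 61 ⟩  ∷ ⟨ 0 , 51 , 91 , 36 ⟩  ∷ ⟨ 0 , 18 , 28 , 71 ⟩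
  ∷ ⟨ 0 , 23 , 7 , 88 ⟩  ∷ ⟨ 0 , 79 , 35 , 52 ⟩  ∷ ⟨ 0 , 24 , 58 , 62 ⟩
  ∷ ⟨ 0 , 12 , 33 , 44 ⟩  ∷ ⟨ 0 , 42 , 57 , 3 ⟩  ∷ ⟨ 0 , 48 , 77 , 31 ⟩
  ∷ ⟨ 0 , 45 , 72 , 25 ⟩  ∷ ⟨ 0 , 37 , 26 , 13 ⟩  ∷ ⟨ 0 , 75 , 84 , 56 ⟩
  ∷ []) _ _

ample₄₃ : Ample 43
ample₄₃ = cyclic 43
  ( ⟨ 0 , 71 , 78 , 43 ⟩  ∷ ⟨ 0 , 89 , 107 , 98 ⟩  ∷ ⟨ 0 , 20 , 4 , 25 ⟩
  ∷ ⟨ 0 , 14 , 59 , 123 ⟩  ∷ ⟨ 0 , 95 , 84 , 27 ⟩  ∷ ⟨ 0 , 62 , 99 , 57 ⟩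
  ∷ ⟨ 0 , 13 , 49 , 37 ⟩  ∷ ⟨ 0 , 53 , 128 , 34 ⟩  ∷ ⟨ 0 , 7 , 88 , 48 ⟩
  ∷ ⟨ 0 , 96 , 60 , 46 ⟩  ∷ ⟨ 0 , 30 , 69 , 41 ⟩  ∷ ⟨ 0 , 86 , 68 , 65 ⟩
  ∷ ⟨ 0 , 3 , 73 , 15 ⟩  ∷ ⟨ 0 , 114 , 51 , 32 ⟩  ∷ ⟨ 0 , 17 , 33 , 91 ⟩
  ∷ ⟨ 0 , 82 , 102 , 29 ⟩  ∷ ⟨ 0 , 97 , 103 , 125 ⟩  ∷ ⟨ 0 , 55 , 42 , 35 ⟩
  ∷ ⟨ 0 , 105 , 100 , 61 ⟩  ∷ ⟨ 0 , 50 , 63 , 52 ⟩  ∷ ⟨ 0 , 83 , 106 , 31 ⟩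
  ∷ []) _ _

-- Small designs verified by evaluation

linked? : ∀ {X : Set} → DecidableEquality X → ∀ (b c : Vec X 4) → Dec (Linked b c)
linked? _≟_ b c = any? λ i → any? λ j → ≡-dec _≟_ _≟_ (adjacent b i) (swap (adjacent c j))

triangle? : ∀ {X : Set} → DecidableEquality X → ∀ (c : Cluster X) → Dec (Triangle c)
triangle? _≟_ (one _)     = yes _
triangle? _≟_ (tri b c d) = linked? _≟_ b c ×-dec linked? _≟_ b d ×-dec linked? _≟_ c d

module Table (k : ℕ) (cs : List (Cluster (Fin k × Fin 3))) where

  _≟ₚ_ : DecidableEquality (Fin k × Fin 3)
  _≟ₚ_ = ≡-dec Fin._≟_ Fin._≟_

  Valid : Set
  Valid = All Triangle cs × (∀ g a h b →
    let p = ((g , a) , (h , b)) in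
    (g ≢ h → One (p ≡_) (pairsOf cs)) × (¬ (g ≢ h) → None (p ≡_) (pairsOf cs)))

  valid? : Dec Valid
  valid? = All.all? (triangle? _≟ₚ_) cs ×-dec (all? λ g → all? λ a → all? λ h → all? λ b →
    let p = ((g , a) , (h , b)) in
    (¬? (g Fin.≟ h) →-dec one? (≡-dec _≟ₚ_ _≟ₚ_ p) (pairsOf cs)) ×-dec
    (¬? (¬? (g Fin.≟ h)) →-dec All.all? (¬? ∘ ≡-dec _≟ₚ_ _≟ₚ_ p) (pairsOf cs)))

  table : Valid → GDD (Fin k)
  table (t , v) = record
    { clusters  = cs
    ; triangles = t
    ; once      = λ { {g , a} {h , b} → proj₁ (v g a h b) }
    ; never     = λ { {g , a} {h , b} → proj₂ (v g a h b) } }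

module Rotation (k : ℕ) .{{_ : NonZero k}} (n : ℕ) (next : Fin k × Fin 3 → Fin k × Fin 3) where

  -- The code 3 g + a stands for the point a of group g.
  decode : ℕ → Fin k × Fin 3
  decode c = (c ℕ./ 3) mod k , c mod 3

  rotated : List (Cluster ℕ) → List (Cluster (Fin k × Fin 3))
  rotated = concatMap λ c → iterate (mapCluster next) (mapCluster decode c) n

-- Fixes the last group pointwise and rotates each of the other three within itself. It has order 3,
-- so two base triangles give six, that is 18 = 12 · 9 / 6 blocks.
next₄ : Fin 4 × Fin 3 → Fin 4 × Fin 3
next₄ (g , a) with g Fin.≟ # 3
... | yes _ = g , a
... | no _  = g , suc (toℕ a) mod 3

pure₄ : Pure 4
pure₄ = Table.table 4 cs (from-yes (Table.valid? 4 cs)) , refl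
  where
  cs = Rotation.rotated 4 3 next₄
    ( tri ⟨ 3 , 8 , 2 , 11 ⟩ ⟨ 11 , 2 , 4 , 7 ⟩ ⟨ 4 , 2 , 8 , 10 ⟩
    ∷ tri ⟨ 9 , 0 , 7 , 4 ⟩ ⟨ 10 , 7 , 0 , 3 ⟩ ⟨ 8 , 3 , 0 , 9 ⟩
    ∷ [])

pure₅ : Pure 5
pure₅ = Table.table 5 cs (from-yes (Table.valid? 5 cs)) , refl
  where
  cs = Rotation.rotated 5 5 (map₁ λ g → suc (toℕ g) mod 5)
    ( tri ⟨ 7 , 2 , 4 , 10 ⟩ ⟨ 0 , 10 , 4 , 12 ⟩ ⟨ 6 , 12 , 4 , 2 ⟩
    ∷ tri ⟨ 13 , 2 , 9 , 3 ⟩ ⟨ 9 , 2 , 8 , 12 ⟩ ⟨ 8 , 2 , 13 , 5 ⟩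
    ∷ [])

-- Has order 15: the first five groups move in a cycle while the second coordinate advances modulo 3
-- in all six. Three base blocks thus give all 18 · 15 / 6 = 45 blocks.
next₆ : Fin 6 × Fin 3 → Fin 6 × Fin 3
next₆ (g , a) with g Fin.≟ # 5
... | yes _ = g , suc (toℕ a) mod 3
... | no _  = Fin.inject₁ (suc (toℕ g) mod 5) , suc (toℕ a) mod 3

design₆ : GDD (Fin 6)
design₆ = Table.table 6 cs (from-yes (Table.valid? 6 cs))
  where
  cs = Rotation.rotated 6 15 next₆
    ( one ⟨ 0 , 4 , 15 , 13 ⟩ ∷ one ⟨ 0 , 3 , 8 , 14 ⟩ ∷ one ⟨ 0 , 16 , 12 , 7 ⟩ ∷ [])

-- The recursion for all large orders

good₀ : Good 0
good₀ = Table.table 0 [] (from-yes (Table.valid? 0 [])) , z≤n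

good₁ : Good 1
good₁ = Table.table 1 [] (from-yes (Table.valid? 1 [])) , z≤n

transversal : ∀ t u w .{{_ : NonZero t}} → Coprime t 12 → u ℕ.≤ t → w ℕ.≤ t → u ℕ.* w ℕ.≤ 92 →
               Ample t → Good u → Good w → Ample (4 ℕ.* t ℕ.+ (u ℕ.+ w))
transversal = fill-transversal pure₄ pure₅ design₆ (from-yes (singles (clusters design₆) ℕ.≤? 45))

construct : ∀ t u w .{{_ : NonZero t}} {_ : True (coprime? t 12)} {_ : True (u ℕ.≤? t)} {_ : True (w ℕ.≤? t)}
            {_ : True (u ℕ.* w ℕ.≤? 92)} → Ample t → Good u → Good w → Ample (4 ℕ.* t ℕ.+ (u ℕ.+ w))
construct t u w {c} {u≤t} {w≤t} {uw} =
  transversal t u w (toWitness c) (toWitness u≤t) (toWitness w≤t) (toWitness uw)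

-- The tightest base case for the constant 300: there are no blocks outside triangles, and the slack
-- 1380 must fit into 5 · 300.
ample₅ : Ample 5
ample₅ = proj₁ pure₅ , from-yes (singles (clusters (proj₁ pure₅)) ℕ.+ 1380 ℕ.≤? 1500)

-- The slack does not fit, as 4 · 300 < 1380; order 4 therefore serves only as a truncated group.
good₄ : Good 4
good₄ = proj₁ pure₄ , from-yes (singles (clusters (proj₁ pure₄)) ℕ.≤? 1200)

good₅ : Good 5
good₅ = ample⇒good {5} ample₅

good₇ : Good 7
good₇ = ample⇒good {7} ample₇

good₁₁ : Good 11
good₁₁ = ample⇒good {11} ample₁₁

good₁₃ : Good 13
good₁₃ = ample⇒good {13} ample₁₃

good₁₇ : Good 17
good₁₇ = ample⇒good {17} ample₁₇

good₁₉ : Good 19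
good₁₉ = ample⇒good {19} ample₁₉

good₂₃ : Good 23
good₂₃ = ample⇒good {23} ample₂₃

ample₂₅ : Ample 25
ample₂₅ = construct 5 5 0 ample₅ good₅ good₀

good₂₅ : Good 25
good₂₅ = ample⇒good {25} ample₂₅

-- These are the orders 25, 31, ..., 103 that may be wanted as t but lie below 104, where the
-- induction begins. Orders 31 and 43 are taken directly from difference families, the others from
-- smaller transversal designs.
small-ample : All (λ a → Ample (6 ℕ.* a ℕ.+ 1)) (applyUpTo (4 ℕ.+_) 14)
small-ample =
    ample₂₅
  ∷ ample₃₁
  ∷ construct 7  5  4 ample₇  good₅  good₄
  ∷ ample₄₃
  ∷ construct 11 5  0 ample₁₁ good₅  good₀
  ∷ construct 11 11 0 ample₁₁ good₁₁ good₀
  ∷ construct 13 5  4 ample₁₃ good₅  good₄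
  ∷ construct 13 11 4 ample₁₃ good₁₁ good₄
  ∷ construct 17 5  0 ample₁₇ good₅  good₀
  ∷ construct 17 11 0 ample₁₇ good₁₁ good₀
  ∷ construct 17 17 0 ample₁₇ good₁₇ good₀
  ∷ construct 19 11 4 ample₁₉ good₁₁ good₄
  ∷ construct 19 17 4 ample₁₉ good₁₇ good₄
  ∷ construct 23 11 0 ample₂₃ good₁₁ good₀
  ∷ []

record Split (s : ℕ) : Set where
  constructor split
  field
    u w     : ℕ
    good-u  : Good u
    good-w  : Good w
    sum≡    : True (u ℕ.+ w ℕ.≟ s)
    u≤25    : True (u ℕ.≤? 25)
    w≤25    : True (w ℕ.≤? 25)
    uw≤92   : True (u ℕ.* w ℕ.≤? 92)

-- As 4 (6 a + 1) = 24 a + 4, one value of u + w in each residue class modulo 24 suffices.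
splits : All Split (applyUpTo (4 ℕ.+_) 24)
splits =
    split 4  0 good₄  good₀ _ _ _ _
  ∷ split 5  0 good₅  good₀ _ _ _ _
  ∷ split 5  1 good₅  good₁ _ _ _ _
  ∷ split 7  0 good₇  good₀ _ _ _ _
  ∷ split 7  1 good₇  good₁ _ _ _ _
  ∷ split 5  4 good₅  good₄ _ _ _ _
  ∷ split 5  5 good₅  good₅ _ _ _ _
  ∷ split 11 0 good₁₁ good₀ _ _ _ _
  ∷ split 11 1 good₁₁ good₁ _ _ _ _
  ∷ split 13 0 good₁₃ good₀ _ _ _ _
  ∷ split 13 1 good₁₃ good₁ _ _ _ _
  ∷ split 11 4 good₁₁ good₄ _ _ _ _
  ∷ split 11 5 good₁₁ good₅ _ _ _ _
  ∷ split 17 0 good₁₇ good₀ _ _ _ _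
  ∷ split 17 1 good₁₇ good₁ _ _ _ _
  ∷ split 19 0 good₁₉ good₀ _ _ _ _
  ∷ split 19 1 good₁₉ good₁ _ _ _ _
  ∷ split 17 4 good₁₇ good₄ _ _ _ _
  ∷ split 17 5 good₁₇ good₅ _ _ _ _
  ∷ split 23 0 good₂₃ good₀ _ _ _ _
  ∷ split 23 1 good₂₃ good₁ _ _ _ _
  ∷ split 25 0 good₂₅ good₀ _ _ _ _
  ∷ split 25 1 good₂₅ good₁ _ _ _ _
  -- Here u w = 92 is the largest product that occurs; it is the origin of the bound 92 and so of
  -- the slack 1380.
  ∷ split 23 4 good₂₃ good₄ _ _ _ _
  ∷ []

-- A common divisor divides 2 (6 a + 1) - 12 a = 2, hence 6 a, hence 1.
6a+1-coprime : ∀ a → Coprime (6 ℕ.* a ℕ.+ 1) 12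
6a+1-coprime a {d} (d∣t , d∣12) = ℕ.∣1⇒≡1
  (ℕ.∣m+n∣m⇒∣n d∣t (subst (d ℕ.∣_) (triple a) (ℕ.∣m⇒∣m*n (3 ℕ.* a) d∣2)))
  where
  triple : ∀ a → 2 ℕ.* (3 ℕ.* a) ≡ 6 ℕ.* a
  triple = solve-∀-ℕ
  d∣2 : d ℕ.∣ 2
  d∣2 = ℕ.∣m+n∣m⇒∣n (subst (d ℕ.∣_) (double a) (ℕ.∣n⇒∣m*n 2 d∣t)) (ℕ.∣m⇒∣m*n a d∣12)
    where
    double : ∀ a → 2 ℕ.* (6 ℕ.* a ℕ.+ 1) ≡ 12 ℕ.* a ℕ.+ 2
    double = solve-∀-ℕ

-- From 104 = 24 · 4 + 8 on, a is at least 4 and t at least 25, the largest size of a truncated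
-- group. For a ≥ 18 the order t is at least 109 and within reach of the induction; for smaller a it
-- is in `small-ample`.
eventually-ample : ∀ m → 104 ℕ.≤ m → Ample m
eventually-ample = <-rec (λ m → 104 ℕ.≤ m → Ample m) step
  where
  module _ (m : ℕ) (rec : ∀ {n} → n ℕ.< m → 104 ℕ.≤ n → Ample n) (104≤m : 104 ℕ.≤ m) where

    a t : ℕ
    a = (m ℕ.∸ 8) ℕ./ 24
    t = 6 ℕ.* a ℕ.+ 1

    -- The residue of m - 8 modulo 24 selects the sum u + w between 4 and 27; the 8 collects the
    -- constant 4 of 4 t = 24 a + 4 and the least sum 4.
    open Split (All.lookup splits (∈-applyUpTo⁺ (4 ℕ.+_) (m%n<n (m ℕ.∸ 8) 24)))

    m≡ : 4 ℕ.* t ℕ.+ (u ℕ.+ w) ≡ m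
    m≡ = begin
      4 ℕ.* t ℕ.+ (u ℕ.+ w)                       ≡⟨ cong (4 ℕ.* t ℕ.+_) (toWitness sum≡) ⟩
      4 ℕ.* t ℕ.+ (4 ℕ.+ (m ℕ.∸ 8) % 24)            ≡⟨ ring a ((m ℕ.∸ 8) % 24) ⟩
      8 ℕ.+ ((m ℕ.∸ 8) % 24 ℕ.+ a ℕ.* 24)           ≡⟨ cong (8 ℕ.+_) (m≡m%n+[m/n]*n (m ℕ.∸ 8) 24) ⟨
      8 ℕ.+ (m ℕ.∸ 8)
        ≡⟨ ℕ.m+[n∸m]≡n (ℕ.≤-trans (from-yes (8 ℕ.≤? 104)) 104≤m) ⟩
      m ∎
      where
      open ≡-Reasoning
      ring : ∀ a r → 4 ℕ.* (6 ℕ.* a ℕ.+ 1) ℕ.+ (4 ℕ.+ r) ≡ 8 ℕ.+ (r ℕ.+ a ℕ.* 24)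
      ring = solve-∀-ℕ

    4≤a : 4 ℕ.≤ a
    4≤a = /-monoˡ-≤ 24 (ℕ.∸-monoˡ-≤ 8 104≤m)

    25≤t : 25 ℕ.≤ t
    25≤t = ℕ.+-monoˡ-≤ 1 (ℕ.*-monoʳ-≤ 6 4≤a)

    t<m : t ℕ.< m
    t<m = begin-strict
      t                     <⟨ ℕ.m<m+n t (ℕ.<-≤-trans (s≤s z≤n) (ℕ.*-monoʳ-≤ 3 25≤t)) ⟩
      4 ℕ.* t                 ≤⟨ ℕ.m≤m+n (4 ℕ.* t) (u ℕ.+ w) ⟩
      4 ℕ.* t ℕ.+ (u ℕ.+ w)       ≡⟨ m≡ ⟩
      m ∎
      where open ℕ.≤-Reasoning

    ample-t : Dec (a ℕ.< 18) → Ample t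
    ample-t (yes a<18) = subst (λ a → Ample (6 ℕ.* a ℕ.+ 1)) (ℕ.m+[n∸m]≡n 4≤a)
      (All.lookup small-ample (∈-applyUpTo⁺ (4 ℕ.+_) (ℕ.∸-monoˡ-< a<18 4≤a)))
    ample-t (no a≮18)  = rec t<m (ℕ.≤-trans (from-yes (104 ℕ.≤? 109))
      (ℕ.+-monoˡ-≤ 1 (ℕ.*-monoʳ-≤ 6 (ℕ.≮⇒≥ a≮18))))

    step : Ample m
    step = subst Ample m≡ (transversal t u w {{ℕ.>-nonZero (ℕ.≤-trans (s≤s z≤n) 25≤t)}} (6a+1-coprime a)
      (ℕ.≤-trans (toWitness u≤25) 25≤t) (ℕ.≤-trans (toWitness w≤25) 25≤t) (toWitness uw≤92)
      (ample-t (a ℕ.<? 18)) good-u good-w)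

-- Adding a point at infinity

-- A block together with its reverse contains each ordered pair of four points once. Placed on a
-- group and the point at infinity, it is the source of the term `m * 2` in the count of single
-- blocks.
quadruple : Design (Fin 4) _≢_
quadruple = record
  { clusters  = cs
  ; triangles = _ ∷ _ ∷ []
  ; once      = λ {x} {y} → proj₁ (spec x y)
  ; never     = λ {x} {y} → proj₂ (spec x y) }
  where
  cs : List (Cluster (Fin 4))
  cs = one (# 0 ∷ # 1 ∷ # 2 ∷ # 3 ∷ []) ∷ one (# 3 ∷ # 2 ∷ # 1 ∷ # 0 ∷ []) ∷ []
  spec : ∀ x y → (x ≢ y → One ((x , y) ≡_) (pairsOf cs)) × (¬ (x ≢ y) → None ((x , y) ≡_) (pairsOf cs))
  spec = from-yes (all? λ x → all? λ y →
    (¬? (x Fin.≟ y) →-dec one? (≡-dec Fin._≟_ Fin._≟_ (x , y)) (pairsOf cs)) ×-dec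
    (¬? (¬? (x Fin.≟ y)) →-dec All.all? (¬? ∘ ≡-dec Fin._≟_ Fin._≟_ (x , y)) (pairsOf cs)))

module _ {X Y : Set} (_≟_ : DecidableEquality Y) (X↔Y : X ↔ Y) (D : Design X _≢_) where

  private
    renamed : Piece Y
    renamed = record { design = D ; embed = Inverse.to X↔Y ; injective = ↔⇒injective X↔Y }

  rename : Design Y _≢_
  rename = union _≢_ (renamed ∷ [])
    (λ {x} {y} x≢y → here
      (Inverse.from X↔Y x , Inverse.from X↔Y y ,
       Inverse.strictlyInverseˡ X↔Y x , Inverse.strictlyInverseˡ X↔Y y ,
       x≢y ∘ ↔⇒injective (↔-sym X↔Y)) [])
    (λ {x} {y} ¬x≢y → (λ (_ , _ , eq , eq′ , k≢l) →
      k≢l (↔⇒injective X↔Y (trans eq (trans (decidable-stable (x ≟ y) ¬x≢y) (sym eq′))))) ∷ [])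

  singles-rename : singles (clusters rename) ≡ singles (clusters D)
  singles-rename = trans (singles-union (renamed ∷ [])) (ℕ.+-identityʳ _)

module Completion (m : ℕ) (D : GDD (Fin m)) where

  Extended : Set
  Extended = Fin 1 ⊎ Fin m × Fin 3

  group∪∞ : Fin m → Fin 4 → Extended
  group∪∞ i zero    = inj₁ zero
  group∪∞ i (suc a) = inj₂ (i , a)

  group∪∞-injective : ∀ i {a b} → group∪∞ i a ≡ group∪∞ i b → a ≡ b
  group∪∞-injective i {zero}  {zero}  _    = refl
  group∪∞-injective i {suc _} {suc _} refl = refl

  in-group : ∀ {i j b} a → group∪∞ j a ≡ inj₂ (i , b) → j ≡ i
  in-group (suc _) refl = refl

  outer : Piece Extended
  outer = record { design = D ; embed = inj₂ ; injective = inj₂-injective }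

  inner : Fin m → Piece Extended
  inner i = record { design = quadruple ; embed = group∪∞ i ; injective = group∪∞-injective i }

  pieces : List (Piece Extended)
  pieces = outer ∷ map inner (allFin m)

  cover-inner : ∀ {x y} i → ¬ Covers outer x y → Covers (inner i) x y →
                (∀ {j} → Covers (inner j) x y → j ≡ i) → One (λ q → Covers q x y) pieces
  cover-inner i ¬o c only = there ¬o (one-map⁺ {f = inner} (unique⇒one (allFin⁺ m) (∈-allFin i) c only))

  covers : ∀ x y → x ≢ y → One (λ q → Covers q x y) pieces
  covers (inj₁ zero)    (inj₁ zero)    x≢y = ⊥-elim (x≢y refl)
  covers (inj₁ zero)    (inj₂ (i , b)) _   = cover-inner i
    (λ { (_ , _ , () , _) })
    (zero , suc b , refl , refl , λ ())
    (λ (_ , b , _ , eq , _) → in-group b eq)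
  covers (inj₂ (i , a)) (inj₁ zero)    _   = cover-inner i
    (λ { (_ , _ , _ , () , _) })
    (suc a , zero , refl , refl , λ ())
    (λ (a , _ , eq , _) → in-group a eq)
  covers (inj₂ (i , a)) (inj₂ (j , b)) x≢y with i Fin.≟ j
  ... | yes refl = cover-inner i
    (λ { (_ , _ , refl , refl , ≢) → ≢ refl })
    (suc a , suc b , refl , refl , λ { refl → x≢y refl })
    (λ (a , _ , eq , _) → in-group a eq)
  ... | no i≢j = here ((i , a) , (j , b) , refl , refl , i≢j)
    (All.map⁺ {f = inner} (All.universal (λ l (a , b , eq , eq′ , _) →
      i≢j (trans (sym (in-group a eq)) (in-group b eq′))) (allFin m)))

  extended : Design Extended _≢_
  extended = union _≢_ pieces
    (λ {x} {y} → covers x y)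
    (λ {x} {y} ¬x≢y →
      (λ { (_ , _ , refl , refl , ≢) → ¬x≢y (≢ ∘ cong proj₁ ∘ inj₂-injective) }) ∷
      All.map⁺ {f = inner} (All.universal (λ { i (_ , _ , refl , refl , ≢) →
        ¬x≢y (≢ ∘ group∪∞-injective i) }) (allFin m)))

  inner-excess : ∀ is → sum (map excess (map inner is)) ≡ length is ℕ.* 2
  inner-excess []       = refl
  inner-excess (i ∷ is) = cong (2 ℕ.+_) (inner-excess is)

  singles-extended : singles (clusters extended) ≡ singles (clusters D) ℕ.+ m ℕ.* 2
  singles-extended = trans (singles-union pieces)
    (cong (singles (clusters D) ℕ.+_) (trans (inner-excess (allFin m))
      (cong (ℕ._* 2) (length-tabulate {n = m} id))))

  numbering : Extended ↔ Fin (suc (m ℕ.* 3))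
  numbering = ↔-sym (+↔⊎ {1}) ↔-∘ (↔-refl ⊎-↔ ↔-sym *↔×)

  completed : Design (Fin (suc (m ℕ.* 3))) _≢_
  completed = rename Fin._≟_ numbering extended

  singles-completed : singles (clusters completed) ≡ singles (clusters D) ℕ.+ m ℕ.* 2
  singles-completed = trans (singles-rename Fin._≟_ numbering extended) singles-extended

-- Trades and defining sets

swapAt : Vec X 4 → Fin 3 → Vec X 4
swapAt (a ∷ b ∷ c ∷ d ∷ []) zero             = b ∷ a ∷ c ∷ d ∷ []
swapAt (a ∷ b ∷ c ∷ d ∷ []) (suc zero)       = a ∷ c ∷ b ∷ d ∷ []
swapAt (a ∷ b ∷ c ∷ d ∷ []) (suc (suc zero)) = a ∷ b ∷ d ∷ c ∷ []

pattern p₁₂ = here refl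
pattern p₁₃ = there (here refl)
pattern p₁₄ = there (there (here refl))
pattern p₂₃ = there (there (there (here refl)))
pattern p₂₄ = there (there (there (there (here refl))))
pattern p₃₄ = there (there (there (there (there (here refl)))))

adjacent∈pairs : ∀ (b : Vec X 4) i → adjacent b i ∈ pairs b
adjacent∈pairs (_ ∷ _ ∷ _ ∷ _ ∷ []) zero             = p₁₂
adjacent∈pairs (_ ∷ _ ∷ _ ∷ _ ∷ []) (suc zero)       = p₂₃
adjacent∈pairs (_ ∷ _ ∷ _ ∷ _ ∷ []) (suc (suc zero)) = p₃₄

-- Transposing neighbours reverses one ordered pair and keeps the other five. This is why links
-- between blocks are required at adjacent positions.
pairs-swapAt⁻ : ∀ (b : Vec X 4) i {r} → r ∈ pairs (swapAt b i) → r ∈ pairs b ⊎ r ≡ swap (adjacent b i)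
pairs-swapAt⁻ (_ ∷ _ ∷ _ ∷ _ ∷ []) zero p₁₂ = inj₂ refl
pairs-swapAt⁻ (_ ∷ _ ∷ _ ∷ _ ∷ []) zero p₁₃ = inj₁ p₂₃
pairs-swapAt⁻ (_ ∷ _ ∷ _ ∷ _ ∷ []) zero p₁₄ = inj₁ p₂₄
pairs-swapAt⁻ (_ ∷ _ ∷ _ ∷ _ ∷ []) zero p₂₃ = inj₁ p₁₃
pairs-swapAt⁻ (_ ∷ _ ∷ _ ∷ _ ∷ []) zero p₂₄ = inj₁ p₁₄
pairs-swapAt⁻ (_ ∷ _ ∷ _ ∷ _ ∷ []) zero p₃₄ = inj₁ p₃₄
pairs-swapAt⁻ (_ ∷ _ ∷ _ ∷ _ ∷ []) (suc zero) p₁₂ = inj₁ p₁₃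
pairs-swapAt⁻ (_ ∷ _ ∷ _ ∷ _ ∷ []) (suc zero) p₁₃ = inj₁ p₁₂
pairs-swapAt⁻ (_ ∷ _ ∷ _ ∷ _ ∷ []) (suc zero) p₁₄ = inj₁ p₁₄
pairs-swapAt⁻ (_ ∷ _ ∷ _ ∷ _ ∷ []) (suc zero) p₂₃ = inj₂ refl
pairs-swapAt⁻ (_ ∷ _ ∷ _ ∷ _ ∷ []) (suc zero) p₂₄ = inj₁ p₃₄
pairs-swapAt⁻ (_ ∷ _ ∷ _ ∷ _ ∷ []) (suc zero) p₃₄ = inj₁ p₂₄
pairs-swapAt⁻ (_ ∷ _ ∷ _ ∷ _ ∷ []) (suc (suc zero)) p₁₂ = inj₁ p₁₂
pairs-swapAt⁻ (_ ∷ _ ∷ _ ∷ _ ∷ []) (suc (suc zero)) p₁₃ = inj₁ p₁₄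
pairs-swapAt⁻ (_ ∷ _ ∷ _ ∷ _ ∷ []) (suc (suc zero)) p₁₄ = inj₁ p₁₃
pairs-swapAt⁻ (_ ∷ _ ∷ _ ∷ _ ∷ []) (suc (suc zero)) p₂₃ = inj₁ p₂₄
pairs-swapAt⁻ (_ ∷ _ ∷ _ ∷ _ ∷ []) (suc (suc zero)) p₂₄ = inj₁ p₂₃
pairs-swapAt⁻ (_ ∷ _ ∷ _ ∷ _ ∷ []) (suc (suc zero)) p₃₄ = inj₂ refl

adjacent-swapAt : ∀ (b : Vec X 4) i → adjacent (swapAt b i) i ≡ swap (adjacent b i)
adjacent-swapAt (_ ∷ _ ∷ _ ∷ _ ∷ []) zero             = refl
adjacent-swapAt (_ ∷ _ ∷ _ ∷ _ ∷ []) (suc zero)       = refl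
adjacent-swapAt (_ ∷ _ ∷ _ ∷ _ ∷ []) (suc (suc zero)) = refl

swapAt-involutive : ∀ (b : Vec X 4) i → swapAt (swapAt b i) i ≡ b
swapAt-involutive (_ ∷ _ ∷ _ ∷ _ ∷ []) zero             = refl
swapAt-involutive (_ ∷ _ ∷ _ ∷ _ ∷ []) (suc zero)       = refl
swapAt-involutive (_ ∷ _ ∷ _ ∷ _ ∷ []) (suc (suc zero)) = refl

swap∈swapAt : ∀ (b : Vec X 4) i → swap (adjacent b i) ∈ pairs (swapAt b i)
swap∈swapAt b i = subst (_∈ pairs (swapAt b i)) (adjacent-swapAt b i) (adjacent∈pairs (swapAt b i) i)

pairs-swapAt⁺ : ∀ (b : Vec X 4) i {r} → r ∈ pairs b → r ∈ pairs (swapAt b i) ⊎ r ≡ adjacent b i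
pairs-swapAt⁺ b i {r} r∈
  with pairs-swapAt⁻ (swapAt b i) i (subst (λ b → r ∈ pairs b) (sym (swapAt-involutive b i)) r∈)
... | inj₁ r∈′ = inj₁ r∈′
... | inj₂ eq  = inj₂ (trans eq (cong swap (adjacent-swapAt b i)))

-- A pair away from the transposition survives it. In `meets` it shows that the altered block is not
-- `c`.
shared-pair : ∀ (b : Vec X 4) i → ∃ λ r → r ∈ pairs b × r ∈ pairs (swapAt b i)
shared-pair (_ ∷ _ ∷ _ ∷ _ ∷ []) zero             = _ , p₃₄ , p₃₄
shared-pair (_ ∷ _ ∷ _ ∷ _ ∷ []) (suc zero)       = _ , p₁₄ , p₁₄
shared-pair (_ ∷ _ ∷ _ ∷ _ ∷ []) (suc (suc zero)) = _ , p₁₂ , p₁₂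

module _ {v : ℕ} where

  ∈⇒appears : ∀ {x y} (b : Block v) → (x , y) ∈ pairs b → Appears x y b
  ∈⇒appears (_ ∷ _ ∷ _ ∷ _ ∷ []) p₁₂ = # 0 , # 1 , s≤s z≤n , refl , refl
  ∈⇒appears (_ ∷ _ ∷ _ ∷ _ ∷ []) p₁₃ = # 0 , # 2 , s≤s z≤n , refl , refl
  ∈⇒appears (_ ∷ _ ∷ _ ∷ _ ∷ []) p₁₄ = # 0 , # 3 , s≤s z≤n , refl , refl
  ∈⇒appears (_ ∷ _ ∷ _ ∷ _ ∷ []) p₂₃ = # 1 , # 2 , s≤s (s≤s z≤n) , refl , refl
  ∈⇒appears (_ ∷ _ ∷ _ ∷ _ ∷ []) p₂₄ = # 1 , # 3 , s≤s (s≤s z≤n) , refl , refl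
  ∈⇒appears (_ ∷ _ ∷ _ ∷ _ ∷ []) p₃₄ = # 2 , # 3 , s≤s (s≤s (s≤s z≤n)) , refl , refl

  appears⇒∈ : ∀ {x y} (b : Block v) → Appears x y b → (x , y) ∈ pairs b
  appears⇒∈ (_ ∷ _ ∷ _ ∷ _ ∷ []) (zero , suc zero , _ , refl , refl)             = p₁₂
  appears⇒∈ (_ ∷ _ ∷ _ ∷ _ ∷ []) (zero , suc (suc zero) , _ , refl , refl)       = p₁₃
  appears⇒∈ (_ ∷ _ ∷ _ ∷ _ ∷ []) (zero , suc (suc (suc zero)) , _ , refl , refl) = p₁₄
  appears⇒∈ (_ ∷ _ ∷ _ ∷ _ ∷ []) (suc zero , suc (suc zero) , _ , refl , refl)   = p₂₃
  appears⇒∈ (_ ∷ _ ∷ _ ∷ _ ∷ []) (suc zero , suc (suc (suc zero)) , _ , refl , refl) = p₂₄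
  appears⇒∈ (_ ∷ _ ∷ _ ∷ _ ∷ []) (suc (suc zero) , suc (suc (suc zero)) , _ , refl , refl) = p₃₄
  appears⇒∈ b (suc zero , suc zero , s≤s () , _)
  appears⇒∈ b (suc (suc zero) , suc zero , s≤s () , _)
  appears⇒∈ b (suc (suc zero) , suc (suc zero) , s≤s (s≤s ()) , _)
  appears⇒∈ b (suc (suc (suc zero)) , suc zero , s≤s () , _)
  appears⇒∈ b (suc (suc (suc zero)) , suc (suc zero) , s≤s (s≤s ()) , _)
  appears⇒∈ b (suc (suc (suc zero)) , suc (suc (suc zero)) , s≤s (s≤s (s≤s ())) , _)

  Proper : Block v → Set
  Proper b = ∀ {x} → (x , x) ∉ pairs b

  proper⇒distinct : ∀ b → Proper b → DistinctEntries b
  proper⇒distinct b proper i j eq with <-cmp i j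
  ... | tri≈ _ i≡j _ = i≡j
  ... | tri< i<j _ _ = ⊥-elim (proper (appears⇒∈ b (i , j , i<j , eq , refl)))
  ... | tri> _ _ j<i = ⊥-elim (proper (appears⇒∈ b (j , i , j<i , refl , eq)))

  proper⇒asymmetric : ∀ b → Proper b → ∀ {x y} → (x , y) ∈ pairs b → (y , x) ∉ pairs b
  proper⇒asymmetric b proper xy yx with ∈⇒appears b xy | ∈⇒appears b yx
  ... | i , j , i<j , eqi , eqj | k , l , k<l , eqk , eql
      with refl ← proper⇒distinct b proper i l (trans eqi (sym eql))
         | refl ← proper⇒distinct b proper j k (trans eqj (sym eqk)) = ℕ.<-asym i<j k<l

  record PairDesign (B : List (Block v)) : Set where
    field
      covered : ∀ {x y} → x ≢ y → One (λ b → (x , y) ∈ pairs b) B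
      proper  : ∀ {b} → b ∈ B → Proper b

    distinct : ∀ {b x y} → b ∈ B → (x , y) ∈ pairs b → x ≢ y
    distinct {b} b∈ xy∈ refl = proper {b} b∈ xy∈

    same-block : ∀ {b c x y} → b ∈ B → c ∈ B → (x , y) ∈ pairs b → (x , y) ∈ pairs c → b ≡ c
    same-block b∈ c∈ xy∈b xy∈c = one-unique (covered (distinct b∈ xy∈b)) b∈ xy∈b c∈ xy∈c

  open PairDesign

  directed : ∀ {B} → PairDesign B → IsDirectedDesign v B
  directed {B} design = (λ b b∈ → proper⇒distinct b (proper design b∈)) , λ x y x≢y →
    let k , xy∈ , only = one-lookup (covered design x≢y)
    in k , ∈⇒appears (List.lookup B k) xy∈ , λ k′ → only k′ ∘ appears⇒∈ (List.lookup B k′)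

  _≟_ : (b c : Block v) → Dec (b ≡ c)
  _≟_ = Vec-≡-dec Fin._≟_

  module Trade {B : List (Block v)} (design : PairDesign B) {b c : Block v} (b∈ : b ∈ B) (c∈ : c ∈ B)
               (i j : Fin 3) (linked : adjacent b i ≡ swap (adjacent c j)) where

    p q : Fin v
    p = proj₁ (adjacent b i)
    q = proj₂ (adjacent b i)

    pq∈b : (p , q) ∈ pairs b
    pq∈b = adjacent∈pairs b i

    qp≡ : (q , p) ≡ adjacent c j
    qp≡ = cong swap linked

    qp∈c : (q , p) ∈ pairs c
    qp∈c = subst (_∈ pairs c) (sym qp≡) (adjacent∈pairs c j)

    b≢c : b ≢ c
    b≢c refl = proper⇒asymmetric b (proper design b∈) pq∈b qp∈c

    p≢q : p ≢ q
    p≢q eq = proper design b∈ (subst (λ x → (p , x) ∈ pairs b) (sym eq) pq∈b)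

    exchange : Block v → Block v
    exchange z with z ≟ b | z ≟ c
    ... | yes _ | _     = swapAt b i
    ... | no _  | yes _ = swapAt c j
    ... | no _  | no _  = z

    data View (z : Block v) : Block v → Set where
      is-b  : z ≡ b → View z (swapAt b i)
      is-c  : z ≡ c → View z (swapAt c j)
      other : z ≢ b → z ≢ c → View z z

    view : ∀ z → View z (exchange z)
    view z with z ≟ b | z ≟ c
    ... | yes eq | _      = is-b eq
    ... | no n   | yes eq = is-c eq
    ... | no n   | no n′  = other n n′

    exchange-b : exchange b ≡ swapAt b i
    exchange-b with exchange b | view b
    ... | _ | is-b _     = refl
    ... | _ | is-c eq    = ⊥-elim (b≢c eq)
    ... | _ | other n _  = ⊥-elim (n refl)

    exchange-c : exchange c ≡ swapAt c j
    exchange-c with exchange c | view c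
    ... | _ | is-b eq    = ⊥-elim (b≢c (sym eq))
    ... | _ | is-c _     = refl
    ... | _ | other _ n  = ⊥-elim (n refl)

    exchange-other : ∀ {z} → z ≢ b → z ≢ c → exchange z ≡ z
    exchange-other {z} ≢b ≢c with exchange z | view z
    ... | _ | is-b eq   = ⊥-elim (≢b eq)
    ... | _ | is-c eq   = ⊥-elim (≢c eq)
    ... | _ | other _ _ = refl

    qp∈b′ : (q , p) ∈ pairs (swapAt b i)
    qp∈b′ = swap∈swapAt b i

    pq∈c′ : (p , q) ∈ pairs (swapAt c j)
    pq∈c′ = subst (_∈ pairs (swapAt c j)) (cong swap (sym qp≡)) (swap∈swapAt c j)

    exchange-proper : ∀ {z} → z ∈ B → Proper (exchange z)
    exchange-proper {z} z∈ {x} xx∈ with exchange z | view z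
    ... | _ | other _ _ = proper design z∈ xx∈
    ... | _ | is-b _ with pairs-swapAt⁻ b i xx∈
    ...   | inj₁ xx∈b = proper design b∈ xx∈b
    ...   | inj₂ eq   = p≢q (trans (sym (cong proj₂ eq)) (cong proj₁ eq))
    exchange-proper {z} z∈ {x} xx∈ | _ | is-c _ with pairs-swapAt⁻ c j xx∈
    ...   | inj₁ xx∈c = proper design c∈ xx∈c
    ...   | inj₂ eq   = p≢q (trans (sym (cong proj₁ eq′)) (cong proj₂ eq′))
      where eq′ = trans eq (cong swap (sym qp≡))

    module _ {r} (r≢pq : r ≢ (p , q)) (r≢qp : r ≢ (q , p)) where

      unmoved⁺ : ∀ {z} → r ∈ pairs z → r ∈ pairs (exchange z)
      unmoved⁺ {z} r∈ with exchange z | view z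
      ... | _ | other _ _ = r∈
      ... | _ | is-b refl with pairs-swapAt⁺ b i r∈
      ...   | inj₁ r∈′ = r∈′
      ...   | inj₂ eq  = ⊥-elim (r≢pq eq)
      unmoved⁺ {z} r∈ | _ | is-c refl with pairs-swapAt⁺ c j r∈
      ...   | inj₁ r∈′ = r∈′
      ...   | inj₂ eq  = ⊥-elim (r≢qp (trans eq (sym qp≡)))

      unmoved⁻ : ∀ {z} → r ∈ pairs (exchange z) → r ∈ pairs z
      unmoved⁻ {z} r∈ with exchange z | view z
      ... | _ | other _ _ = r∈
      ... | _ | is-b refl with pairs-swapAt⁻ b i r∈
      ...   | inj₁ r∈′ = r∈′
      ...   | inj₂ eq  = ⊥-elim (r≢qp eq)
      unmoved⁻ {z} r∈ | _ | is-c refl with pairs-swapAt⁻ c j r∈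
      ...   | inj₁ r∈′ = r∈′
      ...   | inj₂ eq  = ⊥-elim (r≢pq (trans eq (cong swap (sym qp≡))))

    -- After the trade `(p , q)` sits in the altered `c` and `(q , p)` in the altered `b`. The count
    -- for one of these pairs is therefore the old count for the other.
    moved-pq⁺ : ∀ {z} → z ∈ B → (q , p) ∈ pairs z → (p , q) ∈ pairs (exchange z)
    moved-pq⁺ z∈ r∈ with refl ← same-block design c∈ z∈ qp∈c r∈ =
      subst (λ z → (p , q) ∈ pairs z) (sym exchange-c) pq∈c′

    moved-pq⁻ : ∀ {z} → z ∈ B → (p , q) ∈ pairs (exchange z) → (q , p) ∈ pairs z
    moved-pq⁻ {z} z∈ r∈ with exchange z | view z | exchange-proper z∈
    ... | _ | is-b _    | proper′ = ⊥-elim (proper⇒asymmetric (swapAt b i) proper′ r∈ qp∈b′)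
    ... | _ | is-c refl | _       = qp∈c
    ... | _ | other n _ | _       = ⊥-elim (n (same-block design z∈ b∈ r∈ pq∈b))

    moved-qp⁺ : ∀ {z} → z ∈ B → (p , q) ∈ pairs z → (q , p) ∈ pairs (exchange z)
    moved-qp⁺ z∈ r∈ with refl ← same-block design b∈ z∈ pq∈b r∈ =
      subst (λ z → (q , p) ∈ pairs z) (sym exchange-b) qp∈b′

    moved-qp⁻ : ∀ {z} → z ∈ B → (q , p) ∈ pairs (exchange z) → (p , q) ∈ pairs z
    moved-qp⁻ {z} z∈ r∈ with exchange z | view z | exchange-proper z∈
    ... | _ | is-b refl | _       = pq∈b
    ... | _ | is-c _    | proper′ = ⊥-elim (proper⇒asymmetric (swapAt c j) proper′ pq∈c′ r∈)
    ... | _ | other _ n | _       = ⊥-elim (n (same-block design z∈ c∈ r∈ qp∈c))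

    exchanged : PairDesign (map exchange B)
    exchanged .proper z∈ with ∈-map⁻ exchange z∈
    ... | _ , z₀∈ , refl = exchange-proper z₀∈
    exchanged .covered {x} {y} x≢y
      with ≡-dec Fin._≟_ Fin._≟_ (x , y) (p , q) | ≡-dec Fin._≟_ Fin._≟_ (x , y) (q , p)
    ... | yes refl | _        = one-map⁺ (one-cong moved-pq⁺ moved-pq⁻ (covered design (p≢q ∘ sym)))
    ... | no _     | yes refl = one-map⁺ (one-cong moved-qp⁺ moved-qp⁻ (covered design p≢q))
    ... | no ≢pq   | no ≢qp   = one-map⁺ (one-cong (λ {z} _ → unmoved⁺ ≢pq ≢qp {z})
                                                  (λ {z} _ → unmoved⁻ ≢pq ≢qp {z}) (covered design x≢y))

    -- A set avoiding `b` and `c` lies in the traded design as well, so the altered `b` would be a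
    -- block of `B`. As it contains `(q , p)`, it would be `c`; but it still shares a pair with `b`,
    -- which forces `b ≡ c`.
    meets : ∀ {S} → IsDefiningSet v B S → b ∉ S → c ∉ S → ⊥
    meets {S} (_ , S⊆B , defining) b∉S c∉S =
      b≢c (same-block design b∈ c∈ (proj₁ (proj₂ shared))
        (subst (λ z → proj₁ shared ∈ pairs z) b′≡c (proj₂ (proj₂ shared))))
      where
      shared = shared-pair b i
      S⊆B′ : ∀ {s} → s ∈ S → s ∈ map exchange B
      S⊆B′ {s} s∈ = subst (_∈ map exchange B)
        (exchange-other (λ { refl → b∉S s∈ }) (λ { refl → c∉S s∈ })) (∈-map⁺ exchange (S⊆B s∈))
      b′∈B : swapAt b i ∈ B
      b′∈B = Equivalence.to (defining (map exchange B) (directed exchanged) S⊆B′ (swapAt b i))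
               (subst (_∈ map exchange B) exchange-b (∈-map⁺ exchange b∈))
      b′≡c : swapAt b i ≡ c
      b′≡c = same-block design b′∈B c∈ qp∈b′ qp∈c

-- Counting the blocks of a defining set

-- A second copy of `x` would be a second position satisfying `P x`. For blocks, `P b c` says that
-- the first pair of `b` occurs in `c`.
characterised⇒unique : ∀ {xs : List A} (P : A → A → Set) →
  (∀ {x} → x ∈ xs → P x x × One (P x) xs) → Unique xs
characterised⇒unique {xs = []} P _ = []
characterised⇒unique {xs = x ∷ xs} P char =
  All.tabulate (λ y∈ → head (proj₂ (char (here refl))) y∈) ∷
  characterised⇒unique P (λ y∈ → proj₁ (char (there y∈)) , tail (proj₂ (char (there y∈))) y∈)
  where
  head : ∀ {y} → One (P x) (x ∷ xs) → y ∈ xs → x ≢ y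
  head (here p n)   y∈ refl = All.lookup n y∈ p
  head (there ¬p _) y∈ refl = ¬p (proj₁ (char (here refl)))
  tail : ∀ {y} → One (P y) (x ∷ xs) → y ∈ xs → One (P y) xs
  tail (here _ n)  y∈ = ⊥-elim (All.lookup n y∈ (proj₁ (char (there y∈))))
  tail (there _ o) _  = o

two-of-three : ∀ {P : A → Set} (P? : Decidable P) {b c d : A} →
  (¬ P b → ¬ P c → ⊥) → (¬ P b → ¬ P d → ⊥) → (¬ P c → ¬ P d → ⊥) →
  2 ℕ.≤ length (filter P? (b ∷ c ∷ d ∷ []))
two-of-three P? {b} {c} {d} bc bd cd with P? b
... | yes _ with P? c
...   | yes _ = s≤s (s≤s z≤n)
...   | no ¬c with P? d
...     | yes _ = s≤s (s≤s z≤n)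
...     | no ¬d = ⊥-elim (cd ¬c ¬d)
two-of-three P? {b} {c} {d} bc bd cd | no ¬b with P? c
...   | no ¬c = ⊥-elim (bc ¬b ¬c)
...   | yes _ with P? d
...     | yes _ = s≤s (s≤s z≤n)
...     | no ¬d = ⊥-elim (bd ¬b ¬d)

pairs-blocks : ∀ (cs : List (Cluster X)) → concatMap pairs (blocks cs) ≡ pairsOf cs
pairs-blocks []       = refl
pairs-blocks (c ∷ cs) =
  trans (concatMap-++ pairs (members c) (blocks cs)) (cong (clusterPairs c ++_) (pairs-blocks cs))

length-pairs : ∀ (B : List (Vec X 4)) → length (concatMap pairs B) ≡ 6 ℕ.* length B
length-pairs []                         = refl
length-pairs ((_ ∷ _ ∷ _ ∷ _ ∷ []) ∷ B) =
  trans (cong (6 ℕ.+_) (length-pairs B)) (sym (ℕ.*-suc 6 (length B)))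

module DefiningSets {v : ℕ} (D : Design (Fin v) _≢_) where

  B : List (Block v)
  B = blocks (clusters D)

  pairDesign : PairDesign B
  pairDesign = record
    { covered = λ x≢y → one-concatMap⁻ B (subst (One _) (sym (pairs-blocks (clusters D))) (once D x≢y))
    ; proper  = λ {b} b∈ {x} xx∈ → All.lookup (never D {x} {x} (λ ≢ → ≢ refl))
        (subst ((x , x) ∈_) (pairs-blocks (clusters D)) (∈-concatMap⁺ pairs (lose b∈ xx∈))) refl }

  open PairDesign pairDesign

  unique : Unique B
  unique = characterised⇒unique (λ b c → adjacent b zero ∈ pairs c) λ {b} b∈ →
    adjacent∈pairs b zero , covered (distinct b∈ (adjacent∈pairs b zero))

  -- Each ordered pair is diagonal or among the six pairs of some block. This bounds the number of
  -- blocks from below.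
  quadratic : v ℕ.* v ℕ.≤ 6 ℕ.* length B ℕ.+ v
  quadratic = begin
    v ℕ.* v
      ≡⟨ cong₂ ℕ._*_ (length-tabulate {n = v} id) (length-tabulate {n = v} id) ⟨
    length (allFin v) ℕ.* length (allFin v)
      ≡⟨ length-cartesianProduct (allFin v) (allFin v) ⟨
    length (cartesianProduct (allFin v) (allFin v))
      ≤⟨ unique-⊆⇒length-≤ (cartesianProduct⁺ (allFin⁺ v) (allFin⁺ v))
           (λ {r} _ → everywhere r) ⟩
    length (concatMap pairs B ++ map (λ x → x , x) (allFin v)) ≡⟨ length-++ (concatMap pairs B) ⟩
    length (concatMap pairs B) ℕ.+ length (map (λ x → x , x) (allFin v))
      ≡⟨ cong₂ ℕ._+_ (length-pairs B) (trans (length-map _ (allFin v)) (length-tabulate {n = v} id)) ⟩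
    6 ℕ.* length B ℕ.+ v ∎
    where
    open ℕ.≤-Reasoning
    everywhere : ∀ r → r ∈ concatMap pairs B ++ map (λ x → x , x) (allFin v)
    everywhere (x , y) with x Fin.≟ y
    ... | yes refl = ∈-++⁺ʳ (concatMap pairs B) (∈-map⁺ (λ x → x , x) (∈-allFin x))
    ... | no x≢y   with one-witness (covered x≢y)
    ...   | b , b∈ , xy∈ = ∈-++⁺ˡ (∈-concatMap⁺ pairs (lose b∈ xy∈))

  module _ {S : List (Block v)} (S-defining : IsDefiningSet v B S) where

    open DecMembership (_≟_ {v}) using (_∈?_)

    chosen : List (Block v) → List (Block v)
    chosen = filter (_∈? S)

    chosen-++ : ∀ xs ys → length (chosen (xs ++ ys)) ≡ length (chosen xs) ℕ.+ length (chosen ys)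
    chosen-++ xs ys = trans (cong length (filter-++ (_∈? S) xs ys)) (length-++ (chosen xs))

    linked-hit : ∀ {b c} → b ∈ B → c ∈ B → Linked b c → b ∉ S → c ∉ S → ⊥
    linked-hit b∈ c∈ (i , j , eq) = Trade.meets pairDesign b∈ c∈ i j eq S-defining

    -- A triangle contributes 6 on the left and at least 3 · 2 on the right, as two of its blocks
    -- are chosen. A single block contributes 2 on the left, paid by the last term even if it is not
    -- chosen.
    chosen-clusters : ∀ cs → All Triangle cs → (∀ {b} → b ∈ blocks cs → b ∈ B) →
                      2 ℕ.* length (blocks cs) ℕ.≤ 3 ℕ.* length (chosen (blocks cs)) ℕ.+ 2 ℕ.* singles cs
    chosen-clusters [] _ _ = z≤n
    chosen-clusters (one b ∷ cs) (_ ∷ t) sub = begin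
      2 ℕ.* suc (length (blocks cs))
        ≡⟨ ℕ.*-suc 2 (length (blocks cs)) ⟩
      2 ℕ.+ 2 ℕ.* length (blocks cs)
        ≤⟨ ℕ.+-monoʳ-≤ 2 (chosen-clusters cs t (sub ∘ there)) ⟩
      2 ℕ.+ (3 ℕ.* length (chosen (blocks cs)) ℕ.+ 2 ℕ.* singles cs)
        ≡⟨ ring (length (chosen (blocks cs))) (singles cs) ⟩
      3 ℕ.* length (chosen (blocks cs)) ℕ.+ 2 ℕ.* suc (singles cs)
        ≤⟨ ℕ.+-monoˡ-≤ _ (ℕ.*-monoʳ-≤ 3 (ℕ.m≤n+m _ (length (chosen (b ∷ []))))) ⟩
      3 ℕ.* (length (chosen (b ∷ [])) ℕ.+ length (chosen (blocks cs))) ℕ.+ 2 ℕ.* suc (singles cs)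
        ≡⟨ cong (λ n → 3 ℕ.* n ℕ.+ 2 ℕ.* suc (singles cs)) (chosen-++ (b ∷ []) (blocks cs)) ⟨
      3 ℕ.* length (chosen (b ∷ blocks cs)) ℕ.+ 2 ℕ.* suc (singles cs) ∎
      where
      open ℕ.≤-Reasoning
      ring : ∀ l s → 2 ℕ.+ (3 ℕ.* l ℕ.+ 2 ℕ.* s) ≡ 3 ℕ.* l ℕ.+ 2 ℕ.* suc s
      ring = solve-∀-ℕ
    chosen-clusters (tri b c d ∷ cs) ((bc , bd , cd) ∷ t) sub = begin
      2 ℕ.* (3 ℕ.+ length (blocks cs))
        ≡⟨ ℕ.*-distribˡ-+ 2 3 (length (blocks cs)) ⟩
      6 ℕ.+ 2 ℕ.* length (blocks cs)
        ≤⟨ ℕ.+-monoʳ-≤ 6 (chosen-clusters cs t (λ b∈ → sub (there (there (there b∈))))) ⟩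
      6 ℕ.+ (3 ℕ.* length (chosen (blocks cs)) ℕ.+ 2 ℕ.* singles cs)
        ≡⟨ ring (length (chosen (blocks cs))) (singles cs) ⟩
      3 ℕ.* (2 ℕ.+ length (chosen (blocks cs))) ℕ.+ 2 ℕ.* singles cs
        ≤⟨ ℕ.+-monoˡ-≤ _ (ℕ.*-monoʳ-≤ 3 (ℕ.+-monoˡ-≤ (length (chosen (blocks cs))) hits)) ⟩
      3 ℕ.* (length (chosen (b ∷ c ∷ d ∷ [])) ℕ.+ length (chosen (blocks cs))) ℕ.+ 2 ℕ.* singles cs
        ≡⟨ cong (λ n → 3 ℕ.* n ℕ.+ 2 ℕ.* singles cs) (chosen-++ (b ∷ c ∷ d ∷ []) (blocks cs)) ⟨
      3 ℕ.* length (chosen (b ∷ c ∷ d ∷ blocks cs)) ℕ.+ 2 ℕ.* singles cs ∎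
      where
      open ℕ.≤-Reasoning
      ring : ∀ l s → 6 ℕ.+ (3 ℕ.* l ℕ.+ 2 ℕ.* s) ≡ 3 ℕ.* (2 ℕ.+ l) ℕ.+ 2 ℕ.* s
      ring = solve-∀-ℕ
      hits : 2 ℕ.≤ length (chosen (b ∷ c ∷ d ∷ []))
      hits = two-of-three (_∈? S)
        (linked-hit (sub (here refl)) (sub (there (here refl))) bc)
        (linked-hit (sub (here refl)) (sub (there (there (here refl)))) bd)
        (linked-hit (sub (there (here refl))) (sub (there (there (here refl)))) cd)

    defining-bound : 2 ℕ.* length B ℕ.≤ 3 ℕ.* length S ℕ.+ 2 ℕ.* singles (clusters D)
    defining-bound = ℕ.≤-trans (chosen-clusters (clusters D) (triangles D) id)
      (ℕ.+-monoˡ-≤ _ (ℕ.*-monoʳ-≤ 3 (unique-⊆⇒length-≤ (filter⁺ (_∈? S) unique)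
        (λ b∈ → proj₂ (∈-filter⁻ (_∈? S) {xs = B} b∈)))))

    -- Eight times `defining-bound` bounds 16 |B| by 24 |S| plus 16 times the single blocks, and the
    -- latter is at most |B|.
    five-eighths : 16 ℕ.* singles (clusters D) ℕ.≤ length B → 5 ℕ.* length B ℕ.≤ 8 ℕ.* length S
    five-eighths few = ℕ.*-cancelˡ-≤ 3 (ℕ.+-cancelʳ-≤ (length B) _ _ (begin
      3 ℕ.* (5 ℕ.* length B) ℕ.+ length B                        ≡⟨ ring₁ (length B) ⟩
      8 ℕ.* (2 ℕ.* length B)                                   ≤⟨ ℕ.*-monoʳ-≤ 8 defining-bound ⟩
      8 ℕ.* (3 ℕ.* length S ℕ.+ 2 ℕ.* singles (clusters D))
        ≡⟨ ring₂ (length S) (singles (clusters D)) ⟩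
      3 ℕ.* (8 ℕ.* length S) ℕ.+ 16 ℕ.* singles (clusters D)
        ≤⟨ ℕ.+-monoʳ-≤ (3 ℕ.* (8 ℕ.* length S)) few ⟩
      3 ℕ.* (8 ℕ.* length S) ℕ.+ length B ∎))
      where
      open ℕ.≤-Reasoning
      ring₁ : ∀ b → 3 ℕ.* (5 ℕ.* b) ℕ.+ b ≡ 8 ℕ.* (2 ℕ.* b)
      ring₁ = solve-∀-ℕ
      ring₂ : ∀ l s → 8 ℕ.* (3 ℕ.* l ℕ.+ 2 ℕ.* s) ≡ 3 ℕ.* (8 ℕ.* l) ℕ.+ 16 ℕ.* s
      ring₂ = solve-∀-ℕ

-- From integer inequalities to the rational bound

fraction-≤ : ∀ a b c d → a ℕ.* suc d ℕ.≤ c ℕ.* suc b → (+ a) / suc b ≤ (+ c) / suc d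
fraction-≤ a b c d le = ℚ.toℚᵘ-cancel-≤ (begin
  toℚᵘ (fromℚᵘ (mkℚᵘ (+ a) b))   ≃⟨ ℚ.toℚᵘ-fromℚᵘ (mkℚᵘ (+ a) b) ⟩
  mkℚᵘ (+ a) b
    ≤⟨ *≤* (subst₂ ℤ._≤_ (ℤ.pos-* a (suc d)) (ℤ.pos-* c (suc b)) (ℤ.+≤+ le)) ⟩
  mkℚᵘ (+ c) d                   ≃⟨ ℚ.toℚᵘ-fromℚᵘ (mkℚᵘ (+ c) d) ⟨
  toℚᵘ (fromℚᵘ (mkℚᵘ (+ c) d)) ∎)
  where open ℚᵘ.≤-Reasoning

-- The subtracted term is nonnegative, so it is enough that the ratio is at least 5/8.
ratio-bound : ∀ ε → 0ℚ < ε → ∀ v s b .{{_ : NonZero b}} → 5 ℕ.* b ℕ.≤ 8 ℕ.* s →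
              ((+ 5) / 8) - (((+ 13) / 8 + ε) * (1 /ℕ v)) ≤ s /ℕ b
ratio-bound ε 0<ε v s (suc b) le = begin
  (+ 5) / 8 - ((+ 13) / 8 + ε) * (1 /ℕ v)
    ≤⟨ ℚ.+-monoʳ-≤ ((+ 5) / 8) (ℚ.neg-antimono-≤ (nonneg v)) ⟩
  (+ 5) / 8 - 0ℚ                            ≡⟨⟩
  (+ 5) / 8
    ≤⟨ fraction-≤ 5 7 s b (ℕ.≤-trans le (ℕ.≤-reflexive (ℕ.*-comm 8 s))) ⟩
  (+ s) / suc b ∎
  where
  open ℚ.≤-Reasoning
  0≤c : 0ℚ ≤ (+ 13) / 8 + ε
  0≤c = ℚ.+-mono-≤ {0ℚ} {(+ 13) / 8} {0ℚ} {ε} (fraction-≤ 0 0 13 7 z≤n) (ℚ.<⇒≤ 0<ε)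
  nonneg : ∀ v → 0ℚ ≤ ((+ 13) / 8 + ε) * (1 /ℕ v)
  nonneg zero    = ℚ.≤-reflexive (sym (ℚ.*-zeroʳ ((+ 13) / 8 + ε)))
  nonneg (suc v) = subst (_≤ ((+ 13) / 8 + ε) * ((+ 1) / suc v)) (ℚ.*-zeroʳ ((+ 13) / 8 + ε))
    (ℚ.*-monoˡ-≤-nonNeg ((+ 13) / 8 + ε) {{ℚ.nonNegative 0≤c}} (fraction-≤ 0 0 1 v z≤n))

-- 3222 is the least m with 6 · 16 · 302 ≤ 9 m.
module Final (m : ℕ) (3222≤m : 3222 ℕ.≤ m) (D : GDD (Fin m)) (few : singles (clusters D) ℕ.≤ m ℕ.* 300) where
  open Completion m D public using (completed; singles-completed)
  open DefiningSets completed public using (B; pairDesign; quadratic; five-eighths)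

  v : ℕ
  v = suc (m ℕ.* 3)

  -- Here 302 m bounds the single blocks of the completed design: 300 m from `D` and two for each
  -- group with the point at infinity. The quadratic growth comes from v (v - 1) ≥ 9 m² ordered
  -- pairs, six to a block.
  many : 16 ℕ.* (m ℕ.* 302) ℕ.≤ length B
  many = ℕ.*-cancelˡ-≤ 6 (ℕ.+-cancelʳ-≤ v _ _ (begin
    6 ℕ.* (16 ℕ.* (m ℕ.* 302)) ℕ.+ v    ≡⟨ cong (ℕ._+ v) (ring₁ 6 16 302 m) ⟩
    m ℕ.* (6 ℕ.* 16 ℕ.* 302) ℕ.+ v
      ≤⟨ ℕ.+-monoˡ-≤ v (ℕ.*-monoʳ-≤ m
           (ℕ.≤-trans (from-yes (6 ℕ.* 16 ℕ.* 302 ℕ.≤? 3222 ℕ.* 9)) (ℕ.*-monoˡ-≤ 9 3222≤m))) ⟩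
    m ℕ.* (m ℕ.* 9) ℕ.+ v               ≤⟨ ℕ.m≤m+n _ (m ℕ.* 3) ⟩
    m ℕ.* (m ℕ.* 9) ℕ.+ v ℕ.+ m ℕ.* 3   ≡⟨ ring₂ m ⟩
    v ℕ.* v                             ≤⟨ quadratic ⟩
    6 ℕ.* length B ℕ.+ v ∎))
    where
    open ℕ.≤-Reasoning
    ring₁ : ∀ a b c m → a ℕ.* (b ℕ.* (m ℕ.* c)) ≡ m ℕ.* (a ℕ.* b ℕ.* c)
    ring₁ = solve-∀-ℕ
    ring₂ : ∀ m → m ℕ.* (m ℕ.* 9) ℕ.+ suc (m ℕ.* 3) ℕ.+ m ℕ.* 3 ≡ suc (m ℕ.* 3) ℕ.* suc (m ℕ.* 3)
    ring₂ = solve-∀-ℕ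

  few-singles : 16 ℕ.* singles (clusters completed) ℕ.≤ length B
  few-singles = ℕ.≤-trans (ℕ.*-monoʳ-≤ 16 (begin
    singles (clusters completed)         ≡⟨ singles-completed ⟩
    singles (clusters D) ℕ.+ m ℕ.* 2     ≤⟨ ℕ.+-monoˡ-≤ (m ℕ.* 2) few ⟩
    m ℕ.* 300 ℕ.+ m ℕ.* 2                ≡⟨ ℕ.*-distribˡ-+ m 300 2 ⟨
    m ℕ.* 302 ∎)) many
    where open ℕ.≤-Reasoning

  nonempty : NonZero (length B)
  nonempty = ℕ.>-nonZero (ℕ.≤-trans (ℕ.*-mono-≤ {1} {16} (s≤s z≤n)
    (ℕ.*-mono-≤ {1} {m} (ℕ.≤-trans (s≤s z≤n) 3222≤m) (s≤s z≤n))) many)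

  conclusion : ∀ ε → 0ℚ < ε → Σ (List (Block v)) λ B → IsDirectedDesign v B ×
    (∀ S → IsDefiningSet v B S → ((+ 5) / 8) - (((+ 13) / 8 + ε) * (1 /ℕ v)) ≤ length S /ℕ length B)
  conclusion ε 0<ε = B , directed pairDesign , λ S defining →
    ratio-bound ε 0<ε v (length S) (length B) {{nonempty}} (five-eighths defining few-singles)

theorem3p5 : ∀ (ε : ℚ) → 0ℚ < ε →
    Σ ℕ λ v₀ → ∀ (v : ℕ) → v₀ ℕ.< v → v % 3 ≡ 1 →
    Σ (List (Block v)) λ B → IsDirectedDesign v B ×
    (∀ S → IsDefiningSet v B S →
    ((+ 5) / 8) - (((+ 13) / 8 + ε) * (1 /ℕ v)) ≤ length S /ℕ length B)
theorem3p5 ε 0<ε = 3222 ℕ.* 3 , λ v v₀<v v%3≡1 →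
  let m      = v ℕ./ 3
      v≡     = trans (m≡m%n+[m/n]*n v 3) (cong (ℕ._+ m ℕ.* 3) v%3≡1)
      3222≤m = /-monoˡ-≤ 3 (ℕ.<⇒≤ v₀<v)
      D , few = ample⇒good {m} (eventually-ample m (ℕ.≤-trans (from-yes (104 ℕ.≤? 3222)) 3222≤m))
  in subst (λ v → Σ (List (Block v)) λ B → IsDirectedDesign v B ×
       (∀ S → IsDefiningSet v B S → ((+ 5) / 8) - (((+ 13) / 8 + ε) * (1 /ℕ v)) ≤ length S /ℕ length B))
     (sym v≡) (Final.conclusion m 3222≤m D few ε 0<ε)
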